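{- Let $G$ be a countable graph that contains no alternating ray. Then $G$ admits an unfriendly partition, i.e. there is a map $c:V(G)\to\{0,1\}$ such that for every vertex $v\in V(G)$, $$|\{u\in N(v): c(u)\neq c(v)\}|\ \geq\ |\{u\in N(v): c(u)=c(v)\}|$$ (as cardinals), where $N(v)$ is the neighborhood of $v$.
   Context: A ray in a graph is a one-way infinite path $v_0v_1v_2\dots$; it passes through the vertices $v_n$, $n\in\mathbb{N}$. A ray is called alternating if it passes through infinitely many vertices of finite degree and through infinitely many vertices of infinite degree (degrees taken in $G$). A countable graph is one with countably many vertices. -}

module Defs where

open import Data.Nat using (ℕ; suc; _≤_)
open import Data.Bool using (Bool)
open import Data.List using (List)
open import Data.List.Membership.Propositional using (_∈_)
open import Data.Product using (Σ; ∃; _×_)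
open import Relation.Nullary using (¬_; Dec)
open import Relation.Binary.PropositionalEquality using (_≡_; _≢_)
open import Function.Definitions using (Injective)

LEM : Set₁
LEM = (P : Set) → Dec P

record Graph : Set₁ where
  field
    V       : Set
    E       : V → V → Set
    E-sym   : ∀ {u v} → E u v → E v u
    E-irrefl : ∀ {v} → ¬ E v v

Countable : Graph → Set
Countable G = Σ (V → ℕ) (Injective _≡_ _≡_)
  where open Graph G

module _ (G : Graph) where
  open Graph G

  N : V → V → Set
  N v u = E v u

  FiniteSet : (V → Set) → Set
  FiniteSet P = Σ (List V) λ xs → ∀ u → P u → u ∈ xs

  FiniteDegree : V → Set
  FiniteDegree v = FiniteSet (N v)

  _≼_ : (V → Set) → (V → Set) → Set
  B ≼ A = Σ ((u : V) → B u → V) λ f →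
            (∀ u (p : B u) → A (f u p)) ×
            (∀ u u' (p : B u) (p' : B u') → f u p ≡ f u' p' → u ≡ u')

  record Ray : Set where
    field
      vtx   : ℕ → V
      inj   : Injective _≡_ _≡_ vtx
      edge  : ∀ n → E (vtx n) (vtx (suc n))

  Alternating : Ray → Set
  Alternating R =
    (∀ n → ∃ λ m → n ≤ m × FiniteDegree (vtx m)) ×
    (∀ n → ∃ λ m → n ≤ m × ¬ FiniteDegree (vtx m))
    where open Ray R

  Unfriendly : (V → Bool) → Set
  Unfriendly c = ∀ v →
    (λ u → N v u × c u ≡ c v) ≼ (λ u → N v u × c u ≢ c v)

{-# OPTIONS --safe #-}
module Submission where

open import Defs
open import Data.Bool using (Bool; true; false; not; _∧_; _∨_)
import Data.Bool.Properties as Bool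
open import Data.Empty using (⊥; ⊥-elim)
open import Data.List using (List; []; _∷_)
open import Data.List.Membership.Propositional using (_∈_; _∉_)
open import Data.List.Relation.Unary.Any using (here; there)
open import Data.Maybe using (Maybe; just; nothing)
open import Data.Maybe.Properties using (just-injective)
open import Data.Nat using (ℕ; zero; suc; _+_; _∸_; _⊔_; _≤_; _<_; z≤n; s≤s; _≤′_; ≤′-refl; ≤′-step)
open import Data.Nat using (_≤?_; _<?_; _≟_)
open import Data.Nat.Properties
open import Algebra.Properties.CommutativeSemigroup +-commutativeSemigroup using (interchange; xy∙z≈xz∙y)
open import Data.Nat.Solver using (module +-*-Solver)
open import Data.Product using (Σ; ∃; _×_; _,_; proj₁; proj₂)
open import Data.Sum using (_⊎_; inj₁; inj₂; [_,_]′)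
open import Data.Unit using (⊤; tt)
open import Function using (_∘_)
open import Induction.WellFounded using (Acc; acc)
open import Relation.Binary.PropositionalEquality
open import Relation.Nullary using (¬_; Dec; yes; no; does)

-- Transport the graph to ℕ.  Let F be the vertices of finite degree.  The vertices of infinite degree
-- split into X, in which every vertex has infinitely many neighbours in X, and W, where every vertex has
-- infinitely many neighbours in F or infinitely many neighbours of smaller rank in W.  X is coloured greedily,
-- once and for all.  On the rest, keep the edges at F and, for each vertex of W that needs it, edges to
-- infinitely many private children of smaller rank; these form a rayless forest, so a ray meeting W
-- infinitely often would be alternating.
--
-- A colouring is optimal if no finite change on F reduces the number of monochromatic edges at F.  Optimal
-- colourings exist by compactness and satisfy F.  If a vertex of W is unsatisfied, then flipping it makes all
-- but finitely many of its neighbours better off, and a finite change on F restores optimality without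
-- spoiling any other vertex of W.  To satisfy infinitely many vertices of W, take a normal tree order: it is
-- well-founded upwards on W, so by induction the cones above the lowest vertices of W can be treated one after
-- another, and colourings of pieces with finite boundary taken from a sequence of optimal colourings can be
-- spliced into one optimal colouring, because only finitely many ways in which a piece reacts to changes on
-- its boundary have to be matched.

-- Eventual, infinite and bounded properties of natural numbers.

Eventually : (ℕ → Set) → Set
Eventually P = ∃ λ n₀ → ∀ n → n₀ ≤ n → P n

Infinite : (ℕ → Set) → Set
Infinite A = ∀ n → ∃ λ m → n ≤ m × A m

Bounded : (ℕ → Set) → Set
Bounded A = ∃ λ b → ∀ m → A m → m < b

eventually-∩ : ∀ {P Q} → Eventually P → Eventually Q → Eventually (λ n → P n × Q n)
eventually-∩ (a , p) (b , q) =
  a ⊔ b , λ n h → p n (≤-trans (m≤m⊔n a b) h) , q n (≤-trans (m≤n⊔m a b) h)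

eventually-map : ∀ {P Q : ℕ → Set} → (∀ n → P n → Q n) → Eventually P → Eventually Q
eventually-map f (a , p) = a , λ n h → f n (p n h)

infinite-map : ∀ {A B : ℕ → Set} → (∀ n → A n → B n) → Infinite A → Infinite B
infinite-map f I n with I n
... | m , n≤m , a = m , n≤m , f m a

infinite¬bounded : ∀ {A} → Infinite A → ¬ Bounded A
infinite¬bounded I (b , h) with I b
... | m , b≤m , a = <⇒≱ (h m a) b≤m

abstract
  bound-below : (h : ℕ → ℕ) (n : ℕ) → ∃ λ b → n ≤ b × ∀ k → k < n → h k ≤ b
  bound-below h zero = 0 , z≤n , λ _ ()
  bound-below h (suc n) with bound-below h n
  ... | b , n≤b , q = suc b ⊔ h n , ≤-trans (s≤s n≤b) (m≤m⊔n (suc b) (h n)) , go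
    where
    go : ∀ k → k < suc n → h k ≤ suc b ⊔ h n
    go k k<sn with m≤n⇒m<n∨m≡n (≤-pred k<sn)
    ... | inj₁ k<n = ≤-trans (q k k<n) (≤-trans (n≤1+n b) (m≤m⊔n (suc b) (h n)))
    ... | inj₂ refl = m≤n⊔m (suc b) (h n)

-- Sums over pairs `j < i < n`.

sum : ℕ → (ℕ → ℕ) → ℕ
sum zero f = 0
sum (suc n) f = sum n f + f n

sum-mono : ∀ n {f g} → (∀ i → i < n → f i ≤ g i) → sum n f ≤ sum n g
sum-mono zero h = z≤n
sum-mono (suc n) h = +-mono-≤ (sum-mono n (λ i i<n → h i (m≤n⇒m≤1+n i<n))) (h n ≤-refl)

sum-cong : ∀ n {f g} → (∀ i → i < n → f i ≡ g i) → sum n f ≡ sum n g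
sum-cong zero h = refl
sum-cong (suc n) h = cong₂ _+_ (sum-cong n (λ i i<n → h i (m≤n⇒m≤1+n i<n))) (h n ≤-refl)

sum-+ : ∀ n f g → sum n (λ i → f i + g i) ≡ sum n f + sum n g
sum-+ zero f g = refl
sum-+ (suc n) f g =
  trans (cong (_+ (f n + g n)) (sum-+ n f g)) (interchange (sum n f) (sum n g) (f n) (g n))

triangle : (ℕ → ℕ → ℕ) → ℕ → ℕ
triangle g n = sum n (λ i → sum i (g i))

triangle-+ : ∀ g h n → triangle (λ i j → g i j + h i j) n ≡ triangle g n + triangle h n
triangle-+ g h n =
  trans (sum-cong n (λ i _ → sum-+ i (g i) (h i))) (sum-+ n (λ i → sum i (g i)) (λ i → sum i (h i)))

triangle-mono : ∀ {g h} → (∀ i j → g i j ≤ h i j) → ∀ n → triangle g n ≤ triangle h n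
triangle-mono p n = sum-mono n (λ i _ → sum-mono i (λ j _ → p i j))

triangle-cong : ∀ {g h} → (∀ i j → g i j ≡ h i j) → ∀ n → triangle g n ≡ triangle h n
triangle-cong p n = sum-cong n (λ i _ → sum-cong i (λ j _ → p i j))

-- A comparison at `n₁` extends row by row to all later `n`. The constants `k` and `l` carry an
-- error on either side and take the place of subtraction.
triangle-tail′ : ∀ {g h} n₁ → (∀ i j → n₁ ≤ i → j < i → g i j ≤ h i j) → ∀ {k} {l} →
  triangle g n₁ + l ≤ triangle h n₁ + k →
  ∀ {n} → n₁ ≤′ n → triangle g n + l ≤ triangle h n + k
triangle-tail′ n₁ p base ≤′-refl = base
triangle-tail′ {g} {h} n₁ p {k} {l} base (≤′-step {n} n₁≤n) = begin
  triangle g n + sum n (g n) + l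
    ≡⟨ xy∙z≈xz∙y (triangle g n) (sum n (g n)) l ⟩
  triangle g n + l + sum n (g n)
    ≤⟨ +-mono-≤ (triangle-tail′ {g} {h} n₁ p {k} {l} base n₁≤n)
                (sum-mono n (λ j j<n → p n j (≤′⇒≤ n₁≤n) j<n)) ⟩
  triangle h n + k + sum n (h n)
    ≡⟨ xy∙z≈xz∙y (triangle h n) k (sum n (h n)) ⟩
  triangle h n + sum n (h n) + k ∎
  where
  open ≤-Reasoning

triangle-tail : ∀ {g h} n₁ → (∀ i j → n₁ ≤ i → j < i → g i j ≤ h i j) → ∀ {k} {l} →
  triangle g n₁ + l ≤ triangle h n₁ + k →
  Eventually (λ n → triangle g n + l ≤ triangle h n + k)
triangle-tail n₁ p base = n₁ , λ n h → triangle-tail′ n₁ p base (≤⇒≤′ h)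

-- Colourings and their energy.

𝟙 : Bool → ℕ
𝟙 true = 1
𝟙 false = 0

𝟙≤1 : ∀ b → 𝟙 b ≤ 1
𝟙≤1 true = ≤-refl
𝟙≤1 false = z≤n

agree : Bool → Bool → Bool
agree true y = y
agree false y = not y

agree-refl : ∀ x → agree x x ≡ true
agree-refl true = refl
agree-refl false = refl

agree-not : ∀ x → agree x (not x) ≡ false
agree-not true = refl
agree-not false = refl

≢⇒not : ∀ {x y} → x ≢ y → y ≡ not x
≢⇒not {true} {true} h = ⊥-elim (h refl)
≢⇒not {true} {false} h = refl
≢⇒not {false} {true} h = refl
≢⇒not {false} {false} h = ⊥-elim (h refl)

Colouring : Set
Colouring = ℕ → Bool

mono : (ℕ → ℕ → Bool) → Colouring → ℕ → ℕ → ℕ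
mono q c i j = 𝟙 (q i j ∧ agree (c i) (c j))

-- Every edge is counted once, at its larger end.
energy : (ℕ → ℕ → Bool) → Colouring → ℕ → ℕ
energy q c = triangle (mono q c)

_[_≔_] : Colouring → ℕ → Bool → Colouring
(c [ v ≔ x ]) u with u ≟ v
... | yes _ = x
... | no _ = c u

≔-same : ∀ c v x → (c [ v ≔ x ]) v ≡ x
≔-same c v x with v ≟ v
... | yes _ = refl
... | no h = ⊥-elim (h refl)

≔-other : ∀ c {v u} x → u ≢ v → (c [ v ≔ x ]) u ≡ c u
≔-other c {v} {u} x h with u ≟ v
... | yes p = ⊥-elim (h p)
... | no _ = refl

-- The number of pairs `j < i < n`, which bounds every energy independently of the edges and the
-- colouring.
size : ℕ → ℕ
size = triangle (λ _ _ → 1)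

energy≤size : ∀ q c n → energy q c n ≤ size n
energy≤size q c = triangle-mono (λ i j → 𝟙≤1 (q i j ∧ agree (c i) (c j)))

energy-cong : ∀ q c d → (∀ i j → mono q c i j ≡ mono q d i j) → ∀ n → energy q c n ≡ energy q d n
energy-cong q c d h = triangle-cong h

mono-cong : ∀ q (c d : Colouring) i j → (q i j ≡ true → c i ≡ d i × c j ≡ d j) →
  mono q c i j ≡ mono q d i j
mono-cong q c d i j h with q i j
... | false = refl
... | true with h refl
...   | p , r rewrite p | r = refl

-- Least elements, eventual minima and pigeonhole arguments.

module Classical (lem : LEM) where

  ⟪_⟫ : Set → Bool
  ⟪ P ⟫ = does (lem P)

  ⟪⟫-intro : ∀ {P} → P → ⟪ P ⟫ ≡ true
  ⟪⟫-intro {P} p with lem P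
  ... | yes _ = refl
  ... | no ¬p = ⊥-elim (¬p p)

  ⟪⟫-elim : ∀ {P} → ⟪ P ⟫ ≡ true → P
  ⟪⟫-elim {P} h with lem P
  ... | yes p = p
  ... | no _ with () ← h

  by-contradiction : ∀ {P : Set} → ¬ ¬ P → P
  by-contradiction {P} h with lem P
  ... | yes p = p
  ... | no ¬p = ⊥-elim (h ¬p)

  ¬∀⇒∃¬ : ∀ {A : Set} {P : A → Set} → ¬ (∀ x → P x) → ∃ λ x → ¬ P x
  ¬∀⇒∃¬ h = by-contradiction λ k → h λ x → by-contradiction λ ¬p → k (x , ¬p)

  ¬infinite⇒bounded : ∀ {A} → ¬ Infinite A → Bounded A
  ¬infinite⇒bounded h with ¬∀⇒∃¬ h
  ... | n , k = n , λ m a → ≰⇒> λ n≤m → k (m , n≤m , a)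

  ¬bounded⇒infinite : ∀ {A} → ¬ Bounded A → Infinite A
  ¬bounded⇒infinite h = by-contradiction λ k → h (¬infinite⇒bounded k)

  infinite-split : ∀ {A} (P : ℕ → Set) → Infinite A →
    Infinite (λ n → A n × P n) ⊎ Infinite (λ n → A n × ¬ P n)
  infinite-split {A} P I with lem (Infinite (λ n → A n × P n))
  ... | yes h = inj₁ h
  ... | no h with ¬infinite⇒bounded h
  ...   | b , q = inj₂ λ n → let (m , l , a) = I (n ⊔ b) in
            m , ≤-trans (m≤m⊔n n b) l ,
            a , λ p → <⇒≱ (q m (a , p)) (≤-trans (m≤n⊔m n b) l)

  Least : (ℕ → Set) → ℕ → Set
  Least P m = P m × ∀ k → P k → m ≤ k

  least′ : ∀ {P : ℕ → Set} n → (∃ λ m → m < n × P m) → ∃ (Least P)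
  least′ {P} (suc n) (m , m<n , p) with lem (∃ λ k → k < n × P k)
  ... | yes h = least′ n h
  ... | no h = m , p , λ k q → ≤-trans (≤-pred m<n) (≮⇒≥ λ k<n → h (k , k<n , q))

  least : ∀ {P : ℕ → Set} → ∃ P → ∃ (Least P)
  least (m , p) = least′ (suc m) (m , ≤-refl , p)

  Least-unique : ∀ {P Q : ℕ → Set} → (∀ n → P n → Q n) → (∀ n → Q n → P n) →
    ∀ {m k} → Least P m → Least Q k → m ≡ k
  Least-unique f g (p , a) (q , b) = ≤-antisym (a _ (g _ q)) (b _ (f _ p))

  abstract
    -- Total, with value 0 on an empty set, so that `μ-cong` covers empty sets as well.
    μ : (ℕ → Set) → ℕ
    μ P with lem (∃ P)
    ... | yes h = proj₁ (least h)
    ... | no _ = 0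

    μ-Least : ∀ {P} → ∃ P → Least P (μ P)
    μ-Least {P} h with lem (∃ P)
    ... | yes k = proj₂ (least k)
    ... | no k = ⊥-elim (k h)

    μ-cong : ∀ {P Q} → (∀ n → P n → Q n) → (∀ n → Q n → P n) → μ P ≡ μ Q
    μ-cong {P} {Q} f g with lem (∃ P) | lem (∃ Q)
    ... | yes h | yes k = Least-unique f g (proj₂ (least h)) (proj₂ (least k))
    ... | yes (n , p) | no k = ⊥-elim (k (n , f n p))
    ... | no h | yes (n , q) = ⊥-elim (h (n , g n q))
    ... | no _ | no _ = refl

    μ≤ : ∀ {P} b → (∃ P → P b) → μ P ≤ b
    μ≤ {P} b h with lem (∃ P)
    ... | yes k = proj₂ (proj₂ (least k)) b (h k)
    ... | no _ = z≤n

  greatest : ∀ {P : ℕ → Set} B → P 0 → (∀ m → P m → m ≤ B) → ∃ λ m → P m × ¬ P (suc m)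
  greatest {P} B p₀ h = go B 0 p₀ (m≤m+n B 0)
    where
    go : ∀ f m → P m → B ≤ f + m → ∃ λ m → P m × ¬ P (suc m)
    go f m p le with lem (P (suc m))
    ... | no ¬q = m , p , ¬q
    go zero m p le | yes q = ⊥-elim (<⇒≱ (h (suc m) q) le)
    go (suc f) m p le | yes q = go f (suc m) q (≤-trans le (≤-reflexive (sym (+-suc f m))))

  abstract
    -- A minimum exists although the values are only compared eventually, because they are bounded below.
    eventual-minimum : ∀ {C : Set} (K : C → Set) (E : C → ℕ → ℕ) →
      (∀ a b → K a → K b → Eventually (λ n → E a n ≤ E b n) ⊎ Eventually (λ n → suc (E b n) ≤ E a n)) →
      ∀ c B → K c → (∀ a → K a → Eventually (λ n → E c n ≤ E a n + B)) →
      ∃ λ a → K a × ∀ b → K b → Eventually (λ n → E a n ≤ E b n)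
    eventual-minimum {C} K E cmp c B Kc low with greatest B P0 P≤B
      where
      -- `P m` says that some competitor eventually beats `c` by at least `m`. The lower bound caps
      -- `m` by `B`; where `m` is attained and `suc m` is not, the competitor attaining `m` is a
      -- minimum.
      P : ℕ → Set
      P m = ∃ λ a → K a × Eventually (λ n → E a n + m ≤ E c n)
      P0 : P 0
      P0 = c , Kc , 0 , λ n _ → ≤-reflexive (+-identityʳ (E c n))
      P≤B : ∀ m → P m → m ≤ B
      P≤B m (a , Ka , ev) with eventually-∩ ev (low a Ka)
      ... | n , h = let (x , y) = h n ≤-refl in +-cancelˡ-≤ (E a n) m B (≤-trans x y)
    ... | m , (a , Ka , ev) , ¬P = a , Ka , go
      where
      go : ∀ b → K b → Eventually (λ n → E a n ≤ E b n)
      go b Kb with cmp a b Ka Kb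
      ... | inj₁ h = h
      ... | inj₂ h = ⊥-elim (¬P (b , Kb , eventually-map
              (λ n (x , y) → ≤-trans (≤-reflexive (+-suc (E b n) m)) (≤-trans (+-monoˡ-≤ m x) y))
              (eventually-∩ h ev)))

  -- A pigeonhole principle for `R`, quantified over all infinite index sets so that successive
  -- refinements compose.
  Homogeneous : (ℕ → ℕ → Set) → Set₁
  Homogeneous R = ∀ A → Infinite A → Σ (ℕ → Set) λ A′ →
    (∀ n → A′ n → A n) × Infinite A′ × (∀ m n → A′ m → A′ n → R m n)

  homogeneous-× : ∀ {R S} → Homogeneous R → Homogeneous S → Homogeneous (λ m n → R m n × S m n)
  homogeneous-× hR hS A I with hR A I
  ... | B , B⊆A , IB , r with hS B IB
  ...   | C , C⊆B , IC , s = C , (λ n c → B⊆A n (C⊆B n c)) , IC ,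
            λ m n c d → r m n (C⊆B m c) (C⊆B n d) , s m n c d

  homogeneous-map : ∀ {R S : ℕ → ℕ → Set} → (∀ m n → R m n → S m n) → Homogeneous R → Homogeneous S
  homogeneous-map f hR A I with hR A I
  ... | B , B⊆A , IB , r = B , B⊆A , IB , λ m n a b → f m n (r m n a b)

  -- By induction on the bound: either the top value is taken infinitely often, or the infinite set
  -- that avoids it has a smaller bound.
  homogeneous-value : ∀ (o : ℕ → ℕ) b → (∀ n → o n ≤ b) → Homogeneous (λ m n → o m ≡ o n)
  homogeneous-value o b h A I = go b A I (λ n _ → h n)
    where
    go : ∀ b A → Infinite A → (∀ n → A n → o n ≤ b) → Σ (ℕ → Set) λ A′ →
      (∀ n → A′ n → A n) × Infinite A′ × (∀ m n → A′ m → A′ n → o m ≡ o n)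
    go b A I h with infinite-split (λ n → o n ≡ b) I
    ... | inj₁ J = _ , (λ _ → proj₁) , J , λ m n p q → trans (proj₂ p) (sym (proj₂ q))
    go zero A I h | inj₂ J with J 0
    ... | m , _ , a , q = ⊥-elim (q (n≤0⇒n≡0 (h m a)))
    go (suc b) A I h | inj₂ J
      with go b _ J (λ n (a , q) → ≤-pred (≤∧≢⇒< (h n a) q))
    ... | B , B⊆ , IB , r = B , (λ n x → proj₁ (B⊆ n x)) , IB , r

  homogeneous-bool : ∀ (o : ℕ → Bool) → Homogeneous (λ m n → o m ≡ o n)
  homogeneous-bool o = homogeneous-map (λ m n → 𝟙-injective (o m) (o n))
    (homogeneous-value (𝟙 ∘ o) 1 (λ n → 𝟙≤1 (o n)))
    where
    𝟙-injective : ∀ x y → 𝟙 x ≡ 𝟙 y → x ≡ y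
    𝟙-injective true true _ = refl
    𝟙-injective false false _ = refl

  homogeneous-below : ∀ (R : ℕ → ℕ → ℕ → Set) → (∀ k → Homogeneous (R k)) → ∀ b →
    Homogeneous (λ m n → ∀ k → k < b → R k m n)
  homogeneous-below R h zero A I = A , (λ _ a → a) , I , λ _ _ _ _ _ ()
  homogeneous-below R h (suc b) = homogeneous-map join (homogeneous-× (homogeneous-below R h b) (h b))
    where
    join : ∀ m n → (∀ k → k < b → R k m n) × R b m n → ∀ k → k < suc b → R k m n
    join m n (f , r) k k<sb with m≤n⇒m<n∨m≡n (≤-pred k<sb)
    ... | inj₁ k<b = f k k<b
    ... | inj₂ refl = r

  AgreeBelow : ℕ → Colouring → Colouring → Set
  AgreeBelow b c d = ∀ v → v < b → c v ≡ d v

  -- Only finitely many colourings of an initial segment matter, so they can be treated one at a time.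
  homogeneous-colourings : ∀ b (R : Colouring → ℕ → ℕ → Set) →
    (∀ β γ m n → AgreeBelow b β γ → R β m n → R γ m n) →
    (∀ β → Homogeneous (R β)) → Homogeneous (λ m n → ∀ β → R β m n)
  homogeneous-colourings zero R resp h =
    homogeneous-map (λ m n r β → resp _ β m n (λ _ ()) r) (h (λ _ → true))
  homogeneous-colourings (suc b) R resp h = homogeneous-map join
    (homogeneous-colourings b (λ β m n → R (β [ b ≔ true ]) m n × R (β [ b ≔ false ]) m n)
      (λ β γ m n e (p , q) → resp _ _ m n (lift true e) p , resp _ _ m n (lift false e) q)
      (λ β → homogeneous-× (h _) (h _)))
    where
    lift : ∀ {β γ} x → AgreeBelow b β γ → AgreeBelow (suc b) (β [ b ≔ x ]) (γ [ b ≔ x ])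
    lift x e v v<sb with v ≟ b
    ... | yes _ = refl
    ... | no v≢b = e v (≤∧≢⇒< (≤-pred v<sb) v≢b)
    back : ∀ β x → β b ≡ x → AgreeBelow (suc b) (β [ b ≔ x ]) β
    back β x e v v<sb with v ≟ b
    ... | yes refl = sym e
    ... | no _ = refl
    join : ∀ m n → (∀ β → R (β [ b ≔ true ]) m n × R (β [ b ≔ false ]) m n) → ∀ β → R β m n
    join m n f β with β b in eq
    ... | true = resp _ _ m n (back β true eq) (proj₁ (f β))
    ... | false = resp _ _ m n (back β false eq) (proj₂ (f β))

  abstract
    -- A diagonal argument: the infinite sets `S k` shrink, `m k` is taken from `S (suc k)`, and any
    -- member of `S K` is related to all `m k` with `k < K` at once.
    cluster : ∀ (R : ℕ → ℕ → ℕ → Set) → (∀ k → Homogeneous (R k)) →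
      ∃ λ (m : ℕ → ℕ) → (∀ k → k ≤ m k) ×
        ∀ K N → ∃ λ n → N ≤ n × ∀ k → k < K → R k (m k) n
    cluster R h = m , m≥ , near
      where
      S : ℕ → Σ (ℕ → Set) Infinite
      S zero = (λ _ → 0 ≤ 0) , λ n → n , ≤-refl , z≤n
      S (suc k) = let (A , I) = S k ; (B , _ , J , _) = h k A I in B , J
      m : ℕ → ℕ
      m k = proj₁ (proj₂ (S (suc k)) k)
      m≥ : ∀ k → k ≤ m k
      m≥ k = proj₁ (proj₂ (proj₂ (S (suc k)) k))
      m∈ : ∀ k → proj₁ (S (suc k)) (m k)
      m∈ k = proj₂ (proj₂ (proj₂ (S (suc k)) k))
      shrink : ∀ {k l} → k ≤′ l → ∀ n → proj₁ (S l) n → proj₁ (S k) n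
      shrink ≤′-refl n s = s
      shrink (≤′-step {l} k≤l) n s = shrink k≤l n
        (let (A , I) = S l ; (B , B⊆A , _) = h l A I in B⊆A n s)
      near : ∀ K N → ∃ λ n → N ≤ n × ∀ k → k < K → R k (m k) n
      near K N with proj₂ (S K) N
      ... | n , N≤n , s = n , N≤n , λ k k<K →
        (let (A , I) = S k ; (_ , _ , _ , r) = h k A I in r (m k) n (m∈ k)) (shrink (≤⇒≤′ k<K) n s)

-- Finite changes on `F` and optimal colourings.

module Cuts (lem : LEM) (e : ℕ → ℕ → Bool) (e-sym : ∀ i j → e i j ≡ true → e j i ≡ true)
  (F X : ℕ → Set) (X⇒¬F : ∀ v → X v → ¬ F v) (cX : Colouring)
  (F-bounded : ∀ v → F v → Bounded (λ u → e v u ≡ true)) where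

  open Classical lem

  reach : ℕ → ℕ
  reach v with lem (F v)
  ... | yes f = proj₁ (F-bounded v f)
  ... | no _ = 0

  reach-bound : ∀ v u → F v → e v u ≡ true → u < reach v
  reach-bound v u f a with lem (F v)
  ... | yes f′ = proj₂ (F-bounded v f′) u a
  ... | no ¬f = ⊥-elim (¬f f)

  -- Bounds `n` and all neighbours of vertices of `F` below `n`: a change on `F` below `n` affects
  -- only edges with both ends below `nbhd n`.
  nbhd : ℕ → ℕ
  nbhd n = proj₁ (bound-below reach n)

  ≤nbhd : ∀ n → n ≤ nbhd n
  ≤nbhd n = proj₁ (proj₂ (bound-below reach n))

  nbhd-bound : ∀ n v u → F v → v < n → e v u ≡ true → u < nbhd n
  nbhd-bound n v u f v<n a =
    <-≤-trans (reach-bound v u f a) (proj₂ (proj₂ (bound-below reach n)) v v<n)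

  DiffersBelow : ℕ → Colouring → Colouring → Set
  DiffersBelow n c d = ∀ v → c v ≢ d v → F v × v < n

  FinDiff : Colouring → Colouring → Set
  FinDiff c d = ∃ λ n → DiffersBelow n c d

  finDiff-sym : ∀ {c d} → FinDiff c d → FinDiff d c
  finDiff-sym (n , h) = n , λ v p → h v (p ∘ sym)

  finDiff-trans : ∀ {c d f} → FinDiff c d → FinDiff d f → FinDiff c f
  finDiff-trans {c} {d} {f} (n , h) (m , k) = n ⊔ m , go
    where
    go : DiffersBelow (n ⊔ m) c f
    go v p with c v Bool.≟ d v
    ... | no q = proj₁ (h v q) , <-≤-trans (proj₂ (h v q)) (m≤m⊔n n m)
    ... | yes q = let r = k v (λ s → p (trans q s)) in proj₁ r , <-≤-trans (proj₂ r) (m≤n⊔m n m)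

  finDiff-refl : ∀ {c d : Colouring} → (∀ v → c v ≡ d v) → FinDiff c d
  finDiff-refl h = 0 , λ v p → ⊥-elim (p (h v))

  finDiff-outside : ∀ {c d v} → FinDiff c d → ¬ F v → c v ≡ d v
  finDiff-outside {c} {d} {v} (_ , h) ¬f with c v Bool.≟ d v
  ... | yes p = p
  ... | no p = ⊥-elim (¬f (proj₁ (h v p)))

  Sub : (ℕ → ℕ → Bool) → Set
  Sub q = ∀ i j → q i j ≡ true → e i j ≡ true

  -- In a row `i ≥ nbhd n` the colour of `i` is unchanged, and an altered `j` adjacent to `i` would
  -- force `i` below `nbhd n`.
  mono-tail : ∀ {q} → Sub q → ∀ {n c d} → DiffersBelow n c d →
    ∀ i j → nbhd n ≤ i → j < i → mono q c i j ≡ mono q d i j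
  mono-tail {q} q⊆e {n} {c} {d} h i j b≤i j<i = mono-cong q c d i j λ a → eqᵢ , eqⱼ (q⊆e i j a)
    where
    eqᵢ : c i ≡ d i
    eqᵢ with c i Bool.≟ d i
    ... | yes p = p
    ... | no p = ⊥-elim (<⇒≱ (proj₂ (h i p)) (≤-trans (≤nbhd n) b≤i))
    eqⱼ : e i j ≡ true → c j ≡ d j
    eqⱼ a with c j Bool.≟ d j
    ... | yes p = p
    ... | no p = let (f , j<n) = h j p in
                 ⊥-elim (<⇒≱ (nbhd-bound n j i f j<n (e-sym i j a)) b≤i)

  -- Both energies grow by the same amounts from `nbhd n` on, so the comparison there decides all
  -- later ones.
  energy-compare : ∀ {q} → Sub q → ∀ {c d} → FinDiff c d →
    Eventually (λ n → energy q c n ≤ energy q d n) ⊎ Eventually (λ n → suc (energy q d n) ≤ energy q c n)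
  energy-compare {q} q⊆e {c} {d} (n , h) with energy q c (nbhd n) ≤? energy q d (nbhd n)
  ... | yes le = inj₁ (eventually-map (λ _ → +-cancelʳ-≤ 0 _ _)
          (triangle-tail (nbhd n) (λ i j a b → ≤-reflexive (mono-tail q⊆e h i j a b)) {0} {0}
            (+-monoˡ-≤ 0 le)))
  ... | no nle = inj₂ (eventually-map
          (λ m x → subst₂ _≤_ (+-comm _ 1) (+-identityʳ _) x)
          (triangle-tail (nbhd n) (λ i j a b → ≤-reflexive (sym (mono-tail q⊆e h i j a b))) {0} {1}
            (subst₂ _≤_ (+-comm 1 _) (sym (+-identityʳ _)) (≰⇒> nle))))

  energy-close : ∀ {q} → Sub q → ∀ {n c d} → DiffersBelow n c d →
    Eventually (λ m → energy q c m ≤ energy q d m + size (nbhd n))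
  energy-close {q} q⊆e {n} {c} {d} h = eventually-map (λ m x → ≤-trans (m≤m+n _ 0) x)
    (triangle-tail (nbhd n) (λ i j a b → ≤-reflexive (mono-tail q⊆e h i j a b)) {size (nbhd n)} {0}
      (≤-trans (≤-reflexive (+-identityʳ _)) (≤-trans (energy≤size q c (nbhd n)) (m≤n+m _ _))))

  -- The difference of the two energies is eventually constant.
  energy-offset : ∀ {q} → Sub q → ∀ {c d} → FinDiff c d → ∀ {B} →
    Eventually (λ n → energy q d n ≤ energy q c n + B) →
    ∃ λ t → Eventually (λ n → energy q c n + B ≡ energy q d n + t)
  energy-offset {q} q⊆e {c} {d} (n , h) {B} (m , le) =
    t , n₂ , λ k n₂≤k → ≤-antisym (up k n₂≤k) (down k n₂≤k)
    where
    n₂ = nbhd n ⊔ m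
    t = (energy q c n₂ + B) ∸ energy q d n₂
    base : energy q c n₂ + B ≡ energy q d n₂ + t
    base = sym (m+[n∸m]≡n (le n₂ (m≤n⊔m (nbhd n) m)))
    tail : ∀ i j → n₂ ≤ i → j < i → mono q c i j ≡ mono q d i j
    tail i j a b = mono-tail q⊆e h i j (≤-trans (m≤m⊔n (nbhd n) m) a) b
    up : ∀ k → n₂ ≤ k → energy q c k + B ≤ energy q d k + t
    up = proj₂ (triangle-tail n₂ (λ i j a b → ≤-reflexive (tail i j a b)) {t} {B} (≤-reflexive base))
    down : ∀ k → n₂ ≤ k → energy q d k + t ≤ energy q c k + B
    down = proj₂ (triangle-tail n₂ (λ i j a b → ≤-reflexive (sym (tail i j a b))) {B} {t}
      (≤-reflexive (sym base)))

  E : Colouring → ℕ → ℕ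
  E = energy e

  e⊆e : Sub e
  e⊆e _ _ a = a

  -- D restricts the vertices at which c is compared with other colourings.
  OptimalOn : (ℕ → Set) → Colouring → Set
  OptimalOn D c = (∀ v → X v → c v ≡ cX v) ×
    (∀ d → FinDiff c d → (∀ v → c v ≢ d v → D v) → Eventually (λ n → E c n ≤ E d n))

  Optimal : Colouring → Set
  Optimal c = (∀ v → X v → c v ≡ cX v) × (∀ d → FinDiff c d → Eventually (λ n → E c n ≤ E d n))

  -- Competitors differ from `cX` only below `m`, so their energies stay within `size (nbhd m)` of
  -- that of `cX` and `eventual-minimum` applies.
  optimalOn-exists : ∀ m → ∃ λ c → OptimalOn (_< m) c
  optimalOn-exists m with eventual-minimum (DiffersBelow m cX) E
      (λ a b Ka Kb → energy-compare e⊆e (finDiff-trans (finDiff-sym (m , Ka)) (m , Kb)))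
      cX (size (nbhd m)) (λ v p → ⊥-elim (p refl)) (λ a Ka → energy-close e⊆e Ka)
  ... | c , Kc , min = c , (λ v x → sym (finDiff-outside (m , Kc) (X⇒¬F v x))) , opt
    where
    opt : ∀ d → FinDiff c d → (∀ v → c v ≢ d v → v < m) → Eventually (λ n → E c n ≤ E d n)
    opt d (k , h) D = min d Kd
      where
      Kd : DiffersBelow m cX d
      Kd v p with cX v Bool.≟ c v
      ... | no q = Kc v q
      ... | yes q = let r = λ s → p (trans q s) in proj₁ (h v r) , D v r

  flip : ℕ → Colouring → Colouring
  flip y c = c [ y ≔ not (c y) ]

  flip-flip : ∀ y c v → flip y (flip y c) v ≡ c v
  flip-flip y c v with v ≟ y
  ... | no v≢y = ≔-other c _ v≢y
  ... | yes refl rewrite ≔-same c y (not (c y)) = Bool.not-involutive (c y)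

  flip-diff : ∀ {y c d} → FinDiff c d → ¬ F y → FinDiff (flip y c) (flip y d)
  flip-diff {y} {c} {d} (n , h) ¬f = n , go
    where
    go : DiffersBelow n (flip y c) (flip y d)
    go v p with v ≟ y
    ... | no _ = h v p
    ... | yes refl = ⊥-elim (p (cong not (finDiff-outside {c} {d} (n , h) ¬f)))

  -- Flipping y makes all but finitely many of its F-neighbours better off, so only a bounded
  -- amount of energy can then be gained by further finite changes.
  flip-repair : ∀ {c y} → Optimal c → ¬ F y → ¬ X y →
    Bounded (λ u → e u y ≡ true × c u ≢ c y) →
    ∃ λ d → Optimal d × FinDiff (flip y c) d
  flip-repair {c} {y} (cX≡ , opt) ¬f ¬x (b , opp<b) with
    eventual-minimum (FinDiff (flip y c)) E
      (λ a b Ka Kb → energy-compare e⊆e (finDiff-trans (finDiff-sym Ka) Kb))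
      (flip y c) (size n₁ + size n₁) (finDiff-refl (λ _ → refl)) low
    where
    n₁ = b ⊔ suc y
    module _ (d : Colouring) where
      -- An exchange inequality. Edges away from `y` cancel; an edge from `y` to some `i ≥ n₁` is
      -- monochromatic under `c` but not under `flip y c`, so it contributes at most 1 on the left
      -- and at least 1 on the right.
      lhs rhs : ℕ → ℕ → ℕ
      lhs i j = mono e (flip y c) i j + mono e d i j
      rhs i j = mono e c i j + mono e (flip y d) i j
      rows : ∀ i j → n₁ ≤ i → j < i → lhs i j ≤ rhs i j
      rows i j n₁≤i j<i = case (j ≟ y)
        where
        i≢y : i ≢ y
        i≢y refl = <⇒≱ (m≤n⊔m b (suc i)) n₁≤i
        at-y : ∀ w → e i y ≡ w →
          𝟙 (w ∧ agree (flip y c i) (flip y c y)) + 𝟙 (w ∧ agree (d i) (d y)) ≤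
          𝟙 (w ∧ agree (c i) (c y)) + 𝟙 (w ∧ agree (flip y d i) (flip y d y))
        at-y false eq = z≤n
        at-y true eq = subst₂ (λ l r → 𝟙 l + 𝟙 (agree (d i) (d y)) ≤ 𝟙 r + 𝟙 (agree (flip y d i) (flip y d y)))
          (sym (trans (cong₂ agree (trans (≔-other c _ i≢y) ci≡cy) (≔-same c y _)) (agree-not (c y))))
          (sym (trans (cong (λ x → agree x (c y)) ci≡cy) (agree-refl (c y))))
          (≤-trans (𝟙≤1 (agree (d i) (d y))) (m≤m+n 1 _))
          where
          ci≡cy : c i ≡ c y
          ci≡cy with c i Bool.≟ c y
          ... | yes p = p
          ... | no p = ⊥-elim (<⇒≱ (opp<b i (eq , p)) (≤-trans (m≤m⊔n b (suc y)) n₁≤i))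
        case : Dec (j ≡ y) → lhs i j ≤ rhs i j
        case (no j≢y) = ≤-reflexive (cong₂ _+_
          (mono-cong e (flip y c) c i j λ _ → ≔-other c _ i≢y , ≔-other c _ j≢y)
          (mono-cong e d (flip y d) i j λ _ → sym (≔-other d _ i≢y) , sym (≔-other d _ j≢y)))
        case (yes refl) = at-y (e i y) refl
    low : ∀ a → FinDiff (flip y c) a → Eventually (λ n → E (flip y c) n ≤ E a n + (size n₁ + size n₁))
    low a Ka = eventually-map final (eventually-∩ (opt d c~d) ineq)
      where
      -- Undoing the flip turns the competitor `a` into a finite change of `c`, to which the
      -- optimality of `c` applies.
      d = flip y a
      c~d : FinDiff c d
      c~d = finDiff-trans (finDiff-refl (λ v → sym (flip-flip y c v))) (flip-diff Ka ¬f)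
      ineq : Eventually (λ n → triangle (lhs d) n + 0 ≤ triangle (rhs d) n + (size n₁ + size n₁))
      ineq = triangle-tail n₁ (rows d) {size n₁ + size n₁} {0}
        (≤-trans (≤-reflexive (trans (+-identityʳ _) (triangle-+ _ _ n₁)))
          (≤-trans (+-mono-≤ (energy≤size e (flip y c) n₁) (energy≤size e d n₁)) (m≤n+m _ (triangle (rhs d) n₁))))
      final : ∀ n → E c n ≤ E d n × triangle (lhs d) n + 0 ≤ triangle (rhs d) n + (size n₁ + size n₁) →
        E (flip y c) n ≤ E a n + (size n₁ + size n₁)
      final n (p , q) = +-cancelˡ-≤ (E d n) _ _ (begin
        E d n + E (flip y c) n           ≡⟨ +-comm (E d n) _ ⟩
        E (flip y c) n + E d n           ≡⟨ triangle-+ _ _ n ⟨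
        triangle (lhs d) n               ≤⟨ m≤m+n _ 0 ⟩
        triangle (lhs d) n + 0           ≤⟨ q ⟩
        triangle (rhs d) n + S           ≡⟨ cong (_+ S) (triangle-+ _ _ n) ⟩
        E c n + E (flip y d) n + S       ≤⟨ +-monoˡ-≤ S (+-mono-≤ p (≤-reflexive
                                              (energy-cong e (flip y d) a (λ i j →
                                                mono-cong e (flip y d) a i j λ _ →
                                                flip-flip y a i , flip-flip y a j) n))) ⟩
        E d n + E a n + S                ≡⟨ +-assoc (E d n) (E a n) S ⟩
        E d n + (E a n + S)              ∎)
        where
        open ≤-Reasoning
        S = size n₁ + size n₁
  ... | d , K , min = d , (fixed , λ a h → min a (finDiff-trans K h)) , K
    where
    fixed : ∀ v → X v → d v ≡ cX v
    fixed v x = trans (sym (finDiff-outside K (X⇒¬F v x)))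
      (trans (≔-other c _ (λ { refl → ¬x x })) (cX≡ v x))

  -- Splicing colourings along pieces with finite boundary.

  -- π v ≡ just k puts v into piece k; the vertices with π v ≡ nothing form the core.
  module Splice (π : ℕ → Maybe ℕ) (M : ℕ → ℕ)
    (boundary : ∀ u v k → e u v ≡ true → π u ≡ just k →
      π v ≡ just k ⊎ (π v ≡ nothing × (v < M k ⊎ X v)))
    (c : ℕ → Colouring) (opt : ∀ n → OptimalOn (λ v → π v ≡ nothing → v < n) (c n)) where

    -- `Near k` contains both ends of every edge of piece `k`. Outside the piece itself only the
    -- finite `Rim k` can vary, because `X` is fixed.
    Near Rim : ℕ → ℕ → Set
    Near k v = π v ≡ just k ⊎ (π v ≡ nothing × (v < M k ⊎ X v))
    Rim k v = π v ≡ nothing × v < M k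

    -- An edge is labelled by the piece that contains one of its ends, if there is one.
    _or_ : Maybe ℕ → Maybe ℕ → Maybe ℕ
    just k or _ = just k
    nothing or l = l

    label : ℕ → ℕ → Maybe ℕ
    label i j = π i or π j

    -- `is k` selects the edges of piece `k`, `from k` what remains once the pieces below `k` are
    -- peeled off; edges inside the core always remain.
    is from : ℕ → Maybe ℕ → Bool
    is k nothing = false
    is k (just m) with m ≟ k
    ... | yes _ = true
    ... | no _ = false
    from k nothing = true
    from k (just m) with k ≤? m
    ... | yes _ = true
    ... | no _ = false

    select : (Maybe ℕ → Bool) → ℕ → ℕ → Bool
    select s i j = s (label i j) ∧ e i j

    select⊆e : ∀ s → Sub (select s)
    select⊆e s i j h with s (label i j)
    ... | true = h
    select⊆e s i j () | false

    piece : ℕ → ℕ → ℕ → Bool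
    piece k = select (is k)

    Eₖ : ℕ → Colouring → ℕ → ℕ
    Eₖ k = energy (piece k)

    piece-near : ∀ k i j → piece k i j ≡ true → Near k i × Near k j
    piece-near k i j h with π i in eqᵢ | π j in eqⱼ
    piece-near k i j () | nothing | nothing
    piece-near k i j h | nothing | just m with m ≟ k
    piece-near k i j h | nothing | just m | yes refl with boundary j i k (e-sym i j h) eqⱼ
    ... | inj₁ p with () ← trans (sym eqᵢ) p
    ... | inj₂ (_ , p) = inj₂ (refl , p) , inj₁ refl
    piece-near k i j () | nothing | just m | no _
    piece-near k i j h | just m | r with m ≟ k
    piece-near k i j () | just m | r | no _
    piece-near k i j h | just m | r | yes refl =
      inj₁ refl , subst (λ z → z ≡ just k ⊎ (z ≡ nothing × (j < M k ⊎ X j))) eqⱼ (boundary i j k h eqᵢ)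

    is-self : ∀ k → is k (just k) ≢ false
    is-self k p with k ≟ k
    is-self k () | yes _
    ... | no h = h refl

    -- By `boundary`, the other end of an edge leaving piece `k` lies in the core, so the label of
    -- such an edge cannot come from a different piece.
    piece-off : ∀ k i j → is k (label i j) ≡ false → e i j ≡ true → π i ≢ just k × π j ≢ just k
    piece-off k i j off h = offᵢ , offⱼ
      where
      offᵢ : π i ≢ just k
      offᵢ p = is-self k (subst (λ z → is k (z or π j) ≡ false) p off)
      offⱼ : π j ≢ just k
      offⱼ p with boundary j i k (e-sym i j h) p
      ... | inj₁ q = offᵢ q
      ... | inj₂ (q , _) = is-self k (subst₂ (λ x y → is k (x or y) ≡ false) q p off)

    piece-cong : ∀ k a b → (∀ v → Near k v → a v ≡ b v) → ∀ n → Eₖ k a n ≡ Eₖ k b n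
    piece-cong k a b h = energy-cong (piece k) a b λ i j → mono-cong (piece k) a b i j λ p →
      h i (proj₁ (piece-near k i j p)) , h j (proj₂ (piece-near k i j p))

    B : ℕ → ℕ
    B k = size (nbhd (M k))

    mix : (ℕ → Set) → Colouring → Colouring → Colouring
    mix P a b v with lem (P v)
    ... | yes _ = a v
    ... | no _ = b v

    mix-in : ∀ P a b {v} → P v → mix P a b v ≡ a v
    mix-in P a b {v} p with lem (P v)
    ... | yes _ = refl
    ... | no ¬p = ⊥-elim (¬p p)

    mix-out : ∀ P a b {v} → ¬ P v → mix P a b v ≡ b v
    mix-out P a b {v} ¬p with lem (P v)
    ... | yes p = ⊥-elim (¬p p)
    ... | no _ = refl

    -- The offset B k makes room for responses that lower the energy of the piece.
    Response : ℕ → Colouring → Colouring → ℕ → Set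
    Response k β f t = ∃ λ d → FinDiff f d × (∀ v → Rim k v → d v ≡ β v) ×
      Eventually (λ n → Eₖ k d n + B k ≤ Eₖ k f n + t)

    Valid : ℕ → Colouring → Colouring → Set
    Valid k β f = ∀ v → Rim k v → f v ≢ β v → F v

    -- Recolouring only the rim is already a response. Its price is at most `B k` by `energy-close`;
    -- the other `B k` is the offset.
    valid-response : ∀ k β f → Valid k β f → Response k β f (B k + B k)
    valid-response k β f valid = d , (M k , diff) , (λ v → mix-in (Rim k) β f) ,
      eventually-map (λ n h → ≤-trans (+-monoˡ-≤ (B k) h) (≤-reflexive (+-assoc (Eₖ k f n) (B k) (B k))))
        (energy-close (select⊆e (is k)) {M k} {d} {f} (λ v p → diff v (p ∘ sym)))
      where
      d = mix (Rim k) β f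
      diff : DiffersBelow (M k) f d
      diff v p with lem (Rim k v)
      ... | yes r = valid v r p , proj₂ r
      ... | no _ = ⊥-elim (p refl)

    response-valid : ∀ k β f {t} → Response k β f t → Valid k β f
    response-valid k β f (d , (n , diff) , rim , _) v r p =
      proj₁ (diff v (λ q → p (trans q (rim v r))))

    -- The finitely many values of the cost determine how a piece reacts to finite changes of the core.
    cost : ℕ → Colouring → Colouring → ℕ
    cost k β f = μ (Response k β f)

    cost-bounded : ∀ k β f → cost k β f ≤ B k + B k
    cost-bounded k β f = μ≤ (B k + B k) λ (t , r) → valid-response k β f (response-valid k β f r)

    cost-cong : ∀ k β γ f → AgreeBelow (M k) β γ → cost k β f ≡ cost k γ f
    cost-cong k β γ f h = μ-cong
      (λ t (d , fd , rim , ev) → d , fd , (λ v r → trans (rim v r) (h v (proj₂ r))) , ev)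
      (λ t (d , fd , rim , ev) → d , fd , (λ v r → trans (rim v r) (sym (h v (proj₂ r)))) , ev)

    -- Optimality of `c n` is tested on `d₁`, which follows `d` only inside the piece and so leaves
    -- the core alone. Near the piece, `d₁` differs from `d` only on the rim, at a price of at most
    -- `B k`.
    piece-floor : ∀ k n d → FinDiff (c n) d →
      Eventually (λ i → Eₖ k (c n) i ≤ Eₖ k d i + B k)
    piece-floor k n d fd = eventually-map final (eventually-∩ (proj₂ (opt n) d₁ fd₁ core₁) close)
      where
      P : ℕ → Set
      P v = π v ≡ just k
      d₁ d₂ : Colouring
      d₁ = mix P d (c n)
      d₂ = mix (Near k) d d₁
      fd₁ : FinDiff (c n) d₁
      fd₁ = proj₁ fd , go
        where
        go : DiffersBelow (proj₁ fd) (c n) d₁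
        go v p with lem (P v)
        ... | yes _ = proj₂ fd v p
        ... | no _ = ⊥-elim (p refl)
      core₁ : ∀ v → c n v ≢ d₁ v → π v ≡ nothing → v < n
      core₁ v p q with lem (P v)
      ... | yes r with () ← trans (sym q) r
      ... | no _ = ⊥-elim (p refl)
      diff₂ : DiffersBelow (M k) d₁ d₂
      diff₂ v p with lem (Near k v)
      ... | no _ = ⊥-elim (p refl)
      ... | yes (inj₁ r) = ⊥-elim (p (mix-in P d (c n) r))
      ... | yes (inj₂ (r , s)) = go s
        where
        ¬P : ¬ P v
        ¬P q with () ← trans (sym r) q
        p′ : c n v ≢ d v
        p′ q = p (trans (mix-out P d (c n) ¬P) q)
        go : v < M k ⊎ X v → F v × v < M k
        go (inj₁ v<M) = proj₁ (proj₂ fd v p′) , v<M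
        go (inj₂ x) = ⊥-elim (p′ (finDiff-outside fd (X⇒¬F v x)))
      close : Eventually (λ i → Eₖ k d₁ i ≤ Eₖ k d₂ i + B k)
      close = energy-close (select⊆e (is k)) diff₂
      -- Off the piece, `c n` and `d₁` give an edge the same ends; on the piece, the two terms
      -- merely change places.
      pointwise : ∀ i j → mono e (c n) i j + mono (piece k) d₁ i j ≡ mono e d₁ i j + mono (piece k) (c n) i j
      pointwise i j = go (is k (label i j)) refl
        where
        go : ∀ w → is k (label i j) ≡ w →
          mono e (c n) i j + 𝟙 ((w ∧ e i j) ∧ agree (d₁ i) (d₁ j)) ≡
          mono e d₁ i j + 𝟙 ((w ∧ e i j) ∧ agree (c n i) (c n j))
        go true _ = +-comm (mono e (c n) i j) _
        go false eq = cong (_+ 0) (mono-cong e (c n) d₁ i j λ h →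
          let (¬i , ¬j) = piece-off k i j eq h in
          sym (mix-out P d (c n) ¬i) , sym (mix-out P d (c n) ¬j))
      final : ∀ i → E (c n) i ≤ E d₁ i × Eₖ k d₁ i ≤ Eₖ k d₂ i + B k → Eₖ k (c n) i ≤ Eₖ k d i + B k
      final i (p , q) = begin
        Eₖ k (c n) i      ≤⟨ +-cancelˡ-≤ (E d₁ i) _ _ (begin
            E d₁ i + Eₖ k (c n) i   ≡⟨ triangle-+ _ _ i ⟨
            triangle (λ i j → mono e d₁ i j + mono (piece k) (c n) i j) i
                                    ≡⟨ triangle-cong pointwise i ⟨
            triangle (λ i j → mono e (c n) i j + mono (piece k) d₁ i j) i
                                    ≡⟨ triangle-+ _ _ i ⟩
            E (c n) i + Eₖ k d₁ i   ≤⟨ +-monoˡ-≤ _ p ⟩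
            E d₁ i + Eₖ k d₁ i      ∎) ⟩
        Eₖ k d₁ i         ≤⟨ q ⟩
        Eₖ k d₂ i + B k   ≡⟨ cong (_+ B k) (piece-cong k d₂ d (λ v → mix-in (Near k) d d₁) i) ⟩
        Eₖ k d i + B k    ∎
        where open ≤-Reasoning

    -- The change `a` of `c m` is a response to its own rim colours, with some offset `t`. Equal
    -- costs give `c n` a response to the same rim colours with offset at most `t`, hence with no
    -- larger change of energy.
    simulate : ∀ k m n → AgreeBelow (M k) (c m) (c n) → (∀ β → cost k β (c m) ≡ cost k β (c n)) →
      ∀ a → FinDiff (c m) a → ∃ λ d → FinDiff (c n) d × (∀ v → Rim k v → d v ≡ a v) ×
        Eventually (λ i → Eₖ k d i + Eₖ k (c m) i ≤ Eₖ k a i + Eₖ k (c n) i)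
    simulate k m n ag costs a fd with energy-offset (select⊆e (is k)) (finDiff-sym fd) {B k} (piece-floor k m a fd)
    ... | t , exact with proj₁ (μ-Least {Response k a (c n)} (B k + B k , valid-response k a (c n) valid))
      where
      valid : Valid k a (c n)
      valid v r p = proj₁ (proj₂ fd v (λ q → p (trans (sym (ag v (proj₂ r))) q)))
    ... | d , fd′ , rim , ev = d , fd′ , rim , eventually-map final (eventually-∩ ev exact)
      where
      cost≤t : cost k a (c n) ≤ t
      cost≤t = subst (_≤ t) (costs a) (proj₂ (μ-Least (t , self)) t self)
        where
        self : Response k a (c m) t
        self = a , fd , (λ _ _ → refl) , eventually-map (λ _ → ≤-reflexive) exact
      final : ∀ i → Eₖ k d i + B k ≤ Eₖ k (c n) i + cost k a (c n) × Eₖ k a i + B k ≡ Eₖ k (c m) i + t →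
        Eₖ k d i + Eₖ k (c m) i ≤ Eₖ k a i + Eₖ k (c n) i
      final i (p , q) = +-cancelʳ-≤ (B k) _ _ (begin
        x + y + b          ≡⟨ xy∙z≈xz∙y x y b ⟩
        x + b + y          ≤⟨ +-monoˡ-≤ y (≤-trans p (+-monoʳ-≤ z cost≤t)) ⟩
        z + t + y          ≡⟨ rotate z t y ⟩
        z + (y + t)        ≡⟨ cong (z +_) q ⟨
        z + (w + b)        ≡⟨ move z w b ⟩
        w + z + b          ∎)
        where
        open ≤-Reasoning
        open +-*-Solver
        x = Eₖ k d i
        y = Eₖ k (c m) i
        z = Eₖ k (c n) i
        w = Eₖ k a i
        b = B k
        rotate : ∀ z t y → z + t + y ≡ z + (y + t)
        rotate = solve 3 (λ z t y → z :+ t :+ y := z :+ (y :+ t)) refl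
        move : ∀ z w b → z + (w + b) ≡ w + z + b
        move = solve 3 (λ z w b → z :+ (w :+ b) := w :+ z :+ b) refl

    -- Agreement below `suc k` serves `k` as a core vertex; agreement below `M k` and equal costs
    -- serve `k` as a piece.
    Alike : ℕ → ℕ → ℕ → Set
    Alike k m n = (AgreeBelow (suc k) (c m) (c n) × AgreeBelow (M k) (c m) (c n)) ×
      (∀ β → cost k β (c m) ≡ cost k β (c n))

    alike-homogeneous : ∀ k → Homogeneous (Alike k)
    alike-homogeneous k = homogeneous-× (homogeneous-× (agree-below (suc k)) (agree-below (M k)))
      (homogeneous-colourings (M k) (λ β m n → cost k β (c m) ≡ cost k β (c n))
        (λ β γ m n h p → trans (sym (cost-cong k β γ (c m) h)) (trans p (cost-cong k β γ (c n) h)))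
        (λ β → homogeneous-value (λ n → cost k β (c n)) (B k + B k) (λ n → cost-bounded k β (c n))))
      where
      agree-below : ∀ b → Homogeneous (λ m n → AgreeBelow b (c m) (c n))
      agree-below b = homogeneous-below (λ v m n → c m v ≡ c n v) (λ v → homogeneous-bool (λ n → c n v)) b

    abstract
      index : ℕ → ℕ
      index = proj₁ (cluster Alike alike-homogeneous)

      index-≥ : ∀ k → k ≤ index k
      index-≥ = proj₁ (proj₂ (cluster Alike alike-homogeneous))

      index-near : ∀ K m → ∃ λ n → m ≤ n × ∀ k → k < K → Alike k (index k) n
      index-near = proj₂ (proj₂ (cluster Alike alike-homogeneous))

    -- Pieces and core vertices share one numbering: piece `k` and the core vertex `k` both take
    -- their colours from `c (index k)`.
    home : ℕ → ℕ
    home v with π v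
    ... | nothing = v
    ... | just k = k

    home-just : ∀ {v k} → π v ≡ just k → home v ≡ k
    home-just {v} p with π v | p
    ... | just _ | refl = refl

    home-nothing : ∀ {v} → π v ≡ nothing → home v ≡ v
    home-nothing {v} p with π v | p
    ... | nothing | refl = refl

    spliced : Colouring
    spliced v = c (index (home v)) v

    fixed : ∀ n v → X v → c n v ≡ cX v
    fixed n = proj₁ (opt n)

    -- A rim vertex `v` is coloured from `index v`, not from `index k`; both colourings agree at `v`
    -- with a common `c n`. On `X` all colourings coincide.
    spliced-near : ∀ k v → Near k v → spliced v ≡ c (index k) v
    spliced-near k v (inj₁ p) = cong (λ z → c (index z) v) (home-just p)
    spliced-near k v (inj₂ (p , inj₂ x)) = trans (fixed _ v x) (sym (fixed _ v x))
    spliced-near k v (inj₂ (p , inj₁ v<M)) with index-near (suc (v ⊔ k)) 0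
    ... | n , _ , near = trans (cong (λ z → c (index z) v) (home-nothing p))
          (trans (proj₁ (proj₁ (near v (s≤s (m≤m⊔n v k)))) v ≤-refl)
            (sym (proj₂ (proj₁ (near k (s≤s (m≤n⊔m v k)))) v v<M)))

    from-in : ∀ {m k} → k ≤ m → from k (just m) ≡ true
    from-in {m} {k} h with k ≤? m
    ... | yes _ = refl
    ... | no q = ⊥-elim (q h)

    from-step : ∀ k l x y → 𝟙 ((from k l ∧ x) ∧ y) ≡ 𝟙 ((is k l ∧ x) ∧ y) + 𝟙 ((from (suc k) l ∧ x) ∧ y)
    from-step k nothing x y = refl
    from-step k (just m) x y with k ≤? m | m ≟ k | suc k ≤? m
    ... | yes _ | yes refl | yes q = ⊥-elim (1+n≰n q)
    ... | yes _ | yes refl | no _ = sym (+-identityʳ _)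
    ... | yes _ | no _ | yes _ = refl
    ... | yes p | no q | no r = ⊥-elim (r (≤∧≢⇒< p (q ∘ sym)))
    ... | no p | yes refl | _ = ⊥-elim (p ≤-refl)
    ... | no p | no _ | yes r = ⊥-elim (p (≤-trans (n≤1+n k) r))
    ... | no _ | no _ | no _ = refl

    -- Any finite improvement d of the spliced colouring is imitated, piece by piece, by an improvement
    -- of some c n that looks the same on the relevant part of the core.
    module Imitate (d : Colouring) (fd : FinDiff spliced d) where

      L K : ℕ
      L = proj₁ fd
      -- Every changed vertex and every neighbour of one lies below `nbhd L`, and so has its home
      -- below `K`.
      K = proj₁ (bound-below (suc ∘ home) (nbhd L))

      nbhd≤K : nbhd L ≤ K
      nbhd≤K = proj₁ (proj₂ (bound-below (suc ∘ home) (nbhd L)))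

      home<K : ∀ v → v < nbhd L → home v < K
      home<K = proj₂ (proj₂ (bound-below (suc ∘ home) (nbhd L)))

      n : ℕ
      n = proj₁ (index-near K K)

      K≤n : K ≤ n
      K≤n = proj₁ (proj₂ (index-near K K))

      alike : ∀ k → k < K → Alike k (index k) n
      alike = proj₂ (proj₂ (index-near K K))

      Piecewise : ℕ → Colouring → Set
      Piecewise k a = Eventually (λ i → Eₖ k a i + Eₖ k spliced i ≤ Eₖ k d i + Eₖ k (c n) i)

      Answer : ℕ → Set
      Answer k = ∃ λ a → FinDiff (c n) a × (k < K → (∀ v → Rim k v → a v ≡ d v) × Piecewise k a) ×
        (K ≤ k → ∀ v → a v ≡ c n v)

      response-to : ∀ k → k < K → Answer k
      response-to k k<K =
        answer (simulate k (index k) n (proj₂ (proj₁ (alike k k<K))) (proj₂ (alike k k<K)) a diff)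
        where
        a : Colouring
        -- Near piece `k`, `spliced` equals `c (index k)`, so the change can be transplanted into
        -- the latter.
        a = mix (Near k) d (c (index k))
        diff : FinDiff (c (index k)) a
        diff = L , go
          where
          go : DiffersBelow L (c (index k)) a
          go v p with lem (Near k v)
          ... | yes q = proj₂ fd v (λ r → p (trans (sym (spliced-near k v q)) r))
          ... | no _ = ⊥-elim (p refl)
        answer : (∃ λ b → FinDiff (c n) b × (∀ v → Rim k v → b v ≡ a v) ×
          Eventually (λ i → Eₖ k b i + Eₖ k (c (index k)) i ≤ Eₖ k a i + Eₖ k (c n) i)) → Answer k
        answer (b , fb , rim , ev) = b , fb , (λ _ → rim′ , eventually-map convert ev) ,
            λ K≤k → ⊥-elim (<⇒≱ k<K K≤k)
          where
          rim′ : ∀ v → Rim k v → b v ≡ d v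
          rim′ v (p , q) = trans (rim v (p , q)) (mix-in (Near k) d (c (index k)) (inj₂ (p , inj₁ q)))
          convert : ∀ i → Eₖ k b i + Eₖ k (c (index k)) i ≤ Eₖ k a i + Eₖ k (c n) i →
            Eₖ k b i + Eₖ k spliced i ≤ Eₖ k d i + Eₖ k (c n) i
          convert i = subst₂ (λ x y → Eₖ k b i + x ≤ y + Eₖ k (c n) i)
            (sym (piece-cong k spliced (c (index k)) (spliced-near k) i))
            (piece-cong k a d (λ v → mix-in (Near k) d (c (index k))) i)

      abstract
        response : ∀ k → Answer k
        response k = go (k <? K)
          where
          go : Dec (k < K) → Answer k
          go (no k≮K) = c n , finDiff-refl (λ _ → refl) , (λ h → ⊥-elim (k≮K h)) , λ _ _ → refl
          go (yes k<K) = response-to k k<K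

      imitation : Colouring
      imitation v with π v
      ... | just k = proj₁ (response k) v
      ... | nothing with v <? K
      ...   | yes _ = d v
      ...   | no _ = c n v

      imitation-piece : ∀ {k v} → π v ≡ just k → imitation v ≡ proj₁ (response k) v
      imitation-piece {k} {v} p with π v | p
      ... | just _ | refl = refl

      imitation-low : ∀ {v} → π v ≡ nothing → v < K → imitation v ≡ d v
      imitation-low {v} p v<K with π v | p
      ... | nothing | refl with v <? K
      ...   | yes _ = refl
      ...   | no q = ⊥-elim (q v<K)

      imitation-high : ∀ {v} → π v ≡ nothing → ¬ v < K → imitation v ≡ c n v
      imitation-high {v} p v≮K with π v | p
      ... | nothing | refl with v <? K
      ...   | yes q = ⊥-elim (v≮K q)
      ...   | no _ = refl

      L≤K : L ≤ K
      L≤K = ≤-trans (≤nbhd L) nbhd≤K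

      unchanged : ∀ v → ¬ v < L → spliced v ≡ d v
      unchanged v v≮L with spliced v Bool.≟ d v
      ... | yes p = p
      ... | no p = ⊥-elim (v≮L (proj₂ (proj₂ fd v p)))

      core-low : ∀ {v} → π v ≡ nothing → v < K → spliced v ≡ c n v
      core-low {v} p v<K = trans (cong (λ z → c (index z) v) (home-nothing p))
        (proj₁ (proj₁ (alike v v<K)) v ≤-refl)

      -- The delicate case is a rim vertex at or above `K`: the response copies `d`, whereas
      -- `imitation` keeps `c n`. They agree because `d` changes nothing from `L ≤ K` on.
      response-near : ∀ k → k < K → ∀ v → Near k v → proj₁ (response k) v ≡ imitation v
      response-near k k<K v (inj₁ p) = sym (imitation-piece p)
      response-near k k<K v (inj₂ (p , inj₁ v<M)) with v <? K
      ... | yes v<K = trans (proj₁ (proj₁ (proj₂ (proj₂ (response k))) k<K) v (p , v<M)) (sym (imitation-low p v<K))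
      ... | no v≮K = trans (proj₁ (proj₁ (proj₂ (proj₂ (response k))) k<K) v (p , v<M))
            (trans (sym (unchanged v (λ v<L → v≮K (<-≤-trans v<L L≤K))))
              (trans (spliced-near k v (inj₂ (p , inj₁ v<M)))
                (trans (proj₂ (proj₁ (alike k k<K)) v v<M) (sym (imitation-high p v≮K)))))
      response-near k k<K v (inj₂ (p , inj₂ x)) with v <? K
      ... | yes v<K = trans (sym (finDiff-outside (proj₁ (proj₂ (response k))) (X⇒¬F v x)))
            (trans (fixed n v x) (trans (sym (fixed (index (home v)) v x))
              (trans (finDiff-outside fd (X⇒¬F v x)) (sym (imitation-low p v<K)))))
      ... | no v≮K = trans (sym (finDiff-outside (proj₁ (proj₂ (response k))) (X⇒¬F v x)))
            (sym (imitation-high p v≮K))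

      imitation-diff : FinDiff (c n) imitation
      imitation-diff = proj₁ bd ⊔ K , go
        where
        bd = bound-below (λ k → proj₁ (proj₁ (proj₂ (response k)))) K
        go : DiffersBelow (proj₁ bd ⊔ K) (c n) imitation
        go v p with π v in eq
        ... | just k with k <? K
        ...   | yes k<K = let (f , v<b) = proj₂ (proj₁ (proj₂ (response k))) v p in
                f , <-≤-trans v<b (≤-trans (proj₂ (proj₂ bd) k k<K) (m≤m⊔n (proj₁ bd) K))
        ...   | no k≮K = ⊥-elim (p (sym (proj₂ (proj₂ (proj₂ (response k))) (≮⇒≥ k≮K) v)))
        go v p | nothing with v <? K
        ...   | yes v<K = proj₁ (proj₂ fd v (λ q → p (trans (sym (core-low eq v<K)) q))) ,
                <-≤-trans v<K (m≤n⊔m (proj₁ bd) K)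
        ...   | no _ = ⊥-elim (p refl)

      imitation-core : ∀ v → c n v ≢ imitation v → π v ≡ nothing → v < n
      imitation-core v p q with v <? K
      ... | yes v<K = <-≤-trans v<K K≤n
      ... | no v≮K = ⊥-elim (p (sym (imitation-high q v≮K)))

      Out : ℕ → Set
      Out v = ∀ k → π v ≡ just k → K ≤ k

      data Status (v : ℕ) : Set where
        kept : spliced v ≡ d v → imitation v ≡ c n v → Status v
        moved : F v → v < L → π v ≡ nothing → v < K → Status v

      near-core : ∀ v → v < nbhd L → Out v → π v ≡ nothing
      near-core v v<nbhd out = go (π v) refl
        where
        go : ∀ l → π v ≡ l → π v ≡ nothing
        go nothing eq = eq
        go (just k) eq = ⊥-elim (<⇒≱ (subst (_< K) (home-just eq) (home<K v v<nbhd)) (out k eq))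

      status : ∀ v → Out v → Status v
      status v out with spliced v Bool.≟ d v
      ... | no p = let (f , v<L) = proj₂ fd v p in low f v<L (<-≤-trans v<L L≤K)
        where
        low : F v → v < L → v < K → Status v
        low f v<L v<K = moved f v<L core v<K
          where
          core : π v ≡ nothing
          core = near-core v (<-≤-trans v<L (≤nbhd L)) out
      ... | yes p = kept p same
        where
        same : imitation v ≡ c n v
        same = go (π v) refl (v <? K)
          where
          go : ∀ l → π v ≡ l → Dec (v < K) → imitation v ≡ c n v
          go (just k) eq _ = trans (imitation-piece eq) (proj₂ (proj₂ (proj₂ (response k))) (out k eq) v)
          go nothing eq (yes v<K) = trans (imitation-low eq v<K) (trans (sym p) (core-low eq v<K))
          go nothing eq (no v≮K) = imitation-high eq v≮K

      neighbour-low : ∀ u v → F u → u < L → e u v ≡ true → Out v → π v ≡ nothing × v < K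
      neighbour-low u v f u<L a out = near-core v v<nbhd out , <-≤-trans v<nbhd nbhd≤K
        where
        v<nbhd : v < nbhd L
        v<nbhd = nbhd-bound L u v f u<L a

      -- At two kept ends, `imitation` is `c n` and `spliced` is `d`. If one end moved, both lie in
      -- the core below `K`, where `imitation` is `d` and `spliced` is `c n`. Either way both sides
      -- have the same terms.
      rest : ∀ i j → (e i j ≡ true → Out i × Out j) →
        mono e imitation i j + mono e spliced i j ≡ mono e d i j + mono e (c n) i j
      rest i j outs with e i j in eq
      ... | false = refl
      ... | true = go (status i outᵢ) (status j outⱼ)
        where
        outᵢ = proj₁ (outs refl)
        outⱼ = proj₂ (outs refl)
        Goal : Set
        Goal = 𝟙 (agree (imitation i) (imitation j)) + 𝟙 (agree (spliced i) (spliced j)) ≡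
          𝟙 (agree (d i) (d j)) + 𝟙 (agree (c n i) (c n j))
        low : π i ≡ nothing × i < K → π j ≡ nothing × j < K → Goal
        low (p , q) (r , s) = cong₂ (λ x y → 𝟙 x + 𝟙 y)
          (cong₂ agree (imitation-low p q) (imitation-low r s))
          (cong₂ agree (core-low p q) (core-low r s))
        go : Status i → Status j → Goal
        go (moved f l p q) _ = low (p , q) (neighbour-low i j f l eq outⱼ)
        go (kept _ _) (moved f l p q) = low (neighbour-low j i f l (e-sym i j eq) outᵢ) (p , q)
        go (kept p q) (kept r s) = trans
          (cong₂ (λ x y → 𝟙 x + 𝟙 y) (cong₂ agree q s) (cong₂ agree p r))
          (+-comm (𝟙 (agree (c n i) (c n j))) _)

      -- Additive over disjoint edge sets. For all of `e`, combining it with the optimality of `c n`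
      -- against `imitation` leaves that of `spliced` against `d`.
      Balanced : (ℕ → ℕ → Bool) → Set
      Balanced q = Eventually (λ i → energy q imitation i + energy q spliced i ≤ energy q d i + energy q (c n) i)

      balanced-rest : Balanced (select (from K))
      balanced-rest = 0 , λ m _ → ≤-reflexive (trans (sym (triangle-+ _ _ m))
        (trans (triangle-cong (λ i j → pointwise i j (from K (label i j)) refl) m) (triangle-+ _ _ m)))
        where
        out : ∀ i j → from K (label i j) ≡ true → e i j ≡ true → Out i × Out j
        out i j h a = outᵢ , outⱼ
          where
          from-out : ∀ {k} → from K (just k) ≡ true → K ≤ k
          from-out {k} h with K ≤? k
          from-out h | yes p = p
          from-out () | no _
          outᵢ : Out i
          outᵢ k p = from-out (subst (λ z → from K (z or π j) ≡ true) p h)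
          outⱼ : Out j
          outⱼ k p with boundary j i k (e-sym i j a) p
          ... | inj₁ q = outᵢ k q
          ... | inj₂ (q , _) = from-out (subst₂ (λ x y → from K (x or y) ≡ true) q p h)
        pointwise : ∀ i j w → from K (label i j) ≡ w →
          𝟙 ((w ∧ e i j) ∧ agree (imitation i) (imitation j)) + 𝟙 ((w ∧ e i j) ∧ agree (spliced i) (spliced j)) ≡
          𝟙 ((w ∧ e i j) ∧ agree (d i) (d j)) + 𝟙 ((w ∧ e i j) ∧ agree (c n i) (c n j))
        pointwise i j false _ = refl
        pointwise i j true h = rest i j (out i j h)

      split : ∀ k a i → energy (select (from k)) a i ≡ Eₖ k a i + energy (select (from (suc k))) a i
      split k a i = trans (triangle-cong (λ i j → from-step k (label i j) (e i j) (agree (a i) (a j))) i)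
        (triangle-+ _ _ i)

      balanced-step : ∀ k → k < K → Balanced (select (from (suc k))) → Balanced (select (from k))
      balanced-step k k<K bal = eventually-map add (eventually-∩ piecewise bal)
        where
        piecewise : Piecewise k imitation
        piecewise = eventually-map
          (λ i → subst (λ x → x + Eₖ k spliced i ≤ Eₖ k d i + Eₖ k (c n) i)
            (piece-cong k _ imitation (response-near k k<K) i))
          (proj₂ (proj₁ (proj₂ (proj₂ (response k))) k<K))
        S = select (from (suc k))
        add : ∀ i → Eₖ k imitation i + Eₖ k spliced i ≤ Eₖ k d i + Eₖ k (c n) i ×
          energy S imitation i + energy S spliced i ≤ energy S d i + energy S (c n) i →
          energy (select (from k)) imitation i + energy (select (from k)) spliced i ≤
          energy (select (from k)) d i + energy (select (from k)) (c n) i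
        add i (p , q)
          rewrite split k imitation i | split k spliced i | split k d i | split k (c n) i = begin
          (a₁ + b₁) + (a₂ + b₂)   ≡⟨ interchange a₁ b₁ a₂ b₂ ⟩
          (a₁ + a₂) + (b₁ + b₂)   ≤⟨ +-mono-≤ p q ⟩
          (a₃ + a₄) + (b₃ + b₄)   ≡⟨ interchange a₃ a₄ b₃ b₄ ⟩
          (a₃ + b₃) + (a₄ + b₄)   ∎
          where
          open ≤-Reasoning
          a₁ = Eₖ k imitation i
          a₂ = Eₖ k spliced i
          a₃ = Eₖ k d i
          a₄ = Eₖ k (c n) i
          b₁ = energy S imitation i
          b₂ = energy S spliced i
          b₃ = energy S d i
          b₄ = energy S (c n) i

      descend : (P : ℕ → Set) (m : ℕ) → P m → (∀ k → k < m → P (suc k) → P k) → P 0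
      descend P zero p h = p
      descend P (suc m) p h = descend P m (h m ≤-refl p) (λ k k<m → h k (m≤n⇒m≤1+n k<m))

      all-from : ∀ a i → energy (select (from 0)) a i ≡ E a i
      all-from a = triangle-cong λ i j → cong (λ w → 𝟙 ((w ∧ e i j) ∧ agree (a i) (a j))) (always (label i j))
        where
        always : ∀ l → from 0 l ≡ true
        always nothing = refl
        always (just m) = from-in {m} z≤n

      no-gain : Eventually (λ i → E spliced i ≤ E d i)
      no-gain = eventually-map final (eventually-∩
        (proj₂ (opt n) imitation imitation-diff imitation-core)
        (descend (λ k → Balanced (select (from k))) K balanced-rest balanced-step))
        where
        S = select (from 0)
        final : ∀ i → E (c n) i ≤ E imitation i ×
          energy S imitation i + energy S spliced i ≤ energy S d i + energy S (c n) i →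
          E spliced i ≤ E d i
        final i (p , q) rewrite all-from imitation i | all-from spliced i | all-from d i | all-from (c n) i =
          +-cancelˡ-≤ (E imitation i) _ _ (≤-trans q
            (≤-trans (+-monoʳ-≤ (E d i) p) (≤-reflexive (+-comm (E d i) _))))

    spliced-optimal : Optimal spliced
    spliced-optimal = (λ v x → fixed _ v x) , λ d fd → Imitate.no-gain d fd

  -- With every vertex in the core, splicing is the compactness argument: the restriction to changes
  -- below `n` disappears in the limit.
  optimal-exists : ∃ Optimal
  optimal-exists = Splice.spliced (λ _ → nothing) (λ _ → 0) (λ _ _ _ _ ()) c opt ,
    Splice.spliced-optimal (λ _ → nothing) (λ _ → 0) (λ _ _ _ _ ()) c opt
    where
    c : ℕ → Colouring
    c n = proj₁ (optimalOn-exists n)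
    opt : ∀ n → OptimalOn (λ v → _≡_ {A = Maybe ℕ} nothing nothing → v < n) (c n)
    opt n = proj₁ (proj₂ (optimalOn-exists n)) ,
      λ d fd D → proj₂ (proj₂ (optimalOn-exists n)) d fd (λ v p → D v p refl)

-- Normal tree orders.

-- A normal tree order: the ancestors of v are found by repeatedly removing a vertex from the component
-- of v, each time a neighbour of the last one.  Moving towards the least vertex of the component
-- guarantees that v itself is reached.
module NormalTree (lem : LEM) (A : ℕ → ℕ → Set) (A-sym : ∀ {u v} → A u v → A v u) where

  open Classical lem

  data Walk (as : List ℕ) : ℕ → ℕ → ℕ → Set where
    stop : ∀ {v} → v ∉ as → Walk as 0 v v
    step : ∀ {k u v w} → u ∉ as → A u v → Walk as k v w → Walk as (suc k) u w

  Reach : List ℕ → ℕ → ℕ → Set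
  Reach as u v = ∃ λ k → Walk as k u v

  walk-start : ∀ {as k u v} → Walk as k u v → u ∉ as
  walk-start (stop p) = p
  walk-start (step p _ _) = p

  walk-end : ∀ {as k u v} → Walk as k u v → v ∉ as
  walk-end (stop p) = p
  walk-end (step _ _ w) = walk-end w

  walk-zero : ∀ {as u v} → Walk as 0 u v → u ≡ v
  walk-zero (stop _) = refl

  reach-trans : ∀ {as u v w} → Reach as u v → Reach as v w → Reach as u w
  reach-trans (_ , stop _) q = q
  reach-trans (_ , step p a w) q = let (k , r) = reach-trans (_ , w) q in suc k , step p a r

  reach-sym : ∀ {as u v} → Reach as u v → Reach as v u
  reach-sym (_ , stop p) = 0 , stop p
  reach-sym (_ , step p a w) =
    reach-trans (reach-sym (_ , w)) (1 , step (walk-start w) (A-sym a) (stop p))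

  walk-weaken : ∀ {as bs k u v} → (∀ {x} → x ∈ as → x ∈ bs) → Walk bs k u v → Walk as k u v
  walk-weaken s (stop p) = stop (p ∘ s)
  walk-weaken s (step p a w) = step (p ∘ s) a (walk-weaken s w)

  reach-weaken : ∀ {as bs u v} → (∀ {x} → x ∈ as → x ∈ bs) → Reach bs u v → Reach as u v
  reach-weaken s (k , w) = k , walk-weaken s w

  ∉-∷ : ∀ {x r : ℕ} {as} → x ≢ r → x ∉ as → x ∉ r ∷ as
  ∉-∷ p q (here e) = p e
  ∉-∷ p q (there m) = q m

  walk-avoid : ∀ {as k u v} r → Walk as k u v → Walk (r ∷ as) k u v ⊎ ∃ λ j → j ≤ k × Walk as j r v
  walk-avoid {u = u} r w with u ≟ r
  ... | yes refl = inj₂ (_ , ≤-refl , w)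
  walk-avoid r (stop p) | no u≢r = inj₁ (stop (∉-∷ u≢r p))
  walk-avoid r (step p a w) | no u≢r with walk-avoid r w
  ... | inj₁ w′ = inj₁ (step (∉-∷ u≢r p) a w′)
  ... | inj₂ (j , j≤k , w′) = inj₂ (j , m≤n⇒m≤1+n j≤k , w′)

  -- Cut the walk just before its first visit to `r`. Thus, after the removal of `r`, the component
  -- of `v` still contains a neighbour of `r`.
  last-step : ∀ {as k v r} → Walk as k v r → v ≢ r → ∃ λ u → Reach (r ∷ as) v u × A u r
  last-step (stop _) v≢r = ⊥-elim (v≢r refl)
  last-step {v = v} {r} (step {v = v′} p a w) v≢r with v′ ≟ r
  ... | yes refl = v , (0 , stop (∉-∷ v≢r p)) , a
  ... | no v′≢r with last-step w v′≢r
  ...   | u , (k , w′) , b = u , (suc k , step (∉-∷ v≢r p) a w′) , b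

  -- The head is the vertex removed last; adjacency to it makes the removed vertices a path, which
  -- `chain-ray` turns into a ray.
  AfterHead : List ℕ → ℕ → Set
  AfterHead [] r = ⊤
  AfterHead (s ∷ _) r = A s r

  target : List ℕ → ℕ → ℕ
  target as v = μ (Reach as v)

  Entry : List ℕ → ℕ → ℕ → ℕ → Set
  Entry as v k r = AfterHead as r × Reach as v r × Walk as k r (target as v)

  distance : List ℕ → ℕ → ℕ
  distance as v = μ (λ k → ∃ (Entry as v k))

  next : List ℕ → ℕ → ℕ
  next as v = μ (Entry as v (distance as v))

  target-cong : ∀ {as u v} → Reach as u v → target as u ≡ target as v
  target-cong r = μ-cong (λ _ → reach-trans (reach-sym r)) (λ _ → reach-trans r)

  entry-cong : ∀ {as u v} → Reach as u v → ∀ k r → Entry as u k r → Entry as v k r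
  entry-cong {as} r k x (a , b , w) =
    a , reach-trans (reach-sym r) b , subst (Walk as k x) (target-cong r) w

  distance-cong : ∀ {as u v} → Reach as u v → distance as u ≡ distance as v
  distance-cong r = μ-cong (λ k (x , c) → x , entry-cong r k x c)
    (λ k (x , c) → x , entry-cong (reach-sym r) k x c)

  -- The next vertex to be removed depends only on the component, so two vertices share their
  -- ancestors until they are separated.
  next-cong : ∀ {as u v} → Reach as u v → next as u ≡ next as v
  next-cong {as} {u} {v} r = trans
    (μ-cong (λ x → entry-cong r (distance as u) x) (λ x → entry-cong (reach-sym r) (distance as u) x))
    (cong (λ k → μ (Entry as v k)) (distance-cong r))

  Enterable : List ℕ → ℕ → Set
  Enterable as v = ∃ λ r → AfterHead as r × Reach as v r

  distance-least : ∀ {as v} → Enterable as v → Least (λ k → ∃ (Entry as v k)) (distance as v)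
  distance-least {as} {v} (r , a , p) =
    μ-Least (proj₁ walk , r , a , p , proj₂ walk)
    where
    walk : Reach as r (target as v)
    walk = reach-trans (reach-sym p) (proj₁ (μ-Least (r , p)))

  next-entry : ∀ {as v} → Enterable as v → Entry as v (distance as v) (next as v)
  next-entry h = proj₁ (μ-Least (proj₁ (distance-least h)))

  L : ℕ → ℕ → List ℕ
  L v zero = []
  L v (suc i) with lem (v ∈ L v i)
  ... | yes _ = L v i
  ... | no _ = next (L v i) v ∷ L v i

  L-out : ∀ {v i} → v ∉ L v i → L v (suc i) ≡ next (L v i) v ∷ L v i
  L-out {v} {i} p with lem (v ∈ L v i)
  ... | yes q = ⊥-elim (p q)
  ... | no _ = refl

  L-suc : ∀ {v i x} → x ∈ L v i → x ∈ L v (suc i)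
  L-suc {v} {i} p with lem (v ∈ L v i)
  ... | yes _ = p
  ... | no _ = there p

  L-mono′ : ∀ {v i j x} → i ≤′ j → x ∈ L v i → x ∈ L v j
  L-mono′ ≤′-refl p = p
  L-mono′ (≤′-step h) p = L-suc (L-mono′ h p)

  L-mono : ∀ {v i j x} → i ≤ j → x ∈ L v i → x ∈ L v j
  L-mono h = L-mono′ (≤⇒≤′ h)

  ∉-head : ∀ {x r : ℕ} {as} → x ∉ (r ∷ as) → x ≢ r
  ∉-head p refl = p (here refl)

  enterable-next : ∀ {as v} → Enterable as v → v ∉ next as v ∷ as → Enterable (next as v ∷ as) v
  enterable-next {as} {v} h p with last-step (proj₂ (proj₁ (proj₂ (next-entry h)))) (∉-head p)
  ... | u , r , a = u , A-sym a , r

  enterable : ∀ v i → v ∉ L v i → Enterable (L v i) v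
  enterable v zero p = v , tt , 0 , stop p
  enterable v (suc i) p = subst (λ as → Enterable as v) (sym eq)
    (enterable-next (enterable v i q) (subst (v ∉_) eq p))
    where
    q : v ∉ L v i
    q = p ∘ L-suc
    eq : L v (suc i) ≡ next (L v i) v ∷ L v i
    eq = L-out q

  target-reach : ∀ {as v} → v ∉ as → Least (Reach as v) (target as v)
  target-reach p = μ-Least (_ , 0 , stop p)

  -- The second vertex of a shortest walk from `next as v` to the target is adjacent to `next as v`,
  -- hence an admissible entry, one step closer.
  closer : ∀ {as v} → Enterable as v → Reach (next as v ∷ as) v (target as v) →
    target (next as v ∷ as) v ≡ target as v ×
    distance (next as v ∷ as) v < distance as v
  closer {as} {v} h m = same , decrease _ refl (proj₂ (proj₂ (next-entry h)))
    where
    r = next as v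
    v∉ : v ∉ r ∷ as
    v∉ = walk-start (proj₂ m)
    same : target (r ∷ as) v ≡ target as v
    same = ≤-antisym (proj₂ (target-reach v∉) _ m)
      (proj₂ (target-reach (v∉ ∘ there)) _ (reach-weaken there (proj₁ (target-reach v∉))))
    decrease : ∀ k → k ≡ distance as v → Walk as k r (target as v) → distance (r ∷ as) v < k
    decrease zero _ w = ⊥-elim (walk-end (proj₂ m) (here (sym (walk-zero w))))
    decrease (suc k) eq (step {v = q} p a w) with walk-avoid r w
    -- A return to `r` would leave a shorter walk from `r` to the target.
    ... | inj₂ (j , j≤k , w′) = ⊥-elim (1+n≰n (≤-trans
            (subst (_≤ j) (sym eq) (proj₂ (distance-least h) j
              (r , proj₁ (next-entry h) , proj₁ (proj₂ (next-entry h)) , w′))) j≤k))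
    ... | inj₁ w′ = s≤s (proj₂ (distance-least (enterable-next h v∉)) k
            (q , a , reach-trans m (reach-sym (_ , w′)) , subst (Walk (r ∷ as) k q) (sym same) w′))

  -- A lexicographic descent: while the target stays in the component of `v`, the distance drops;
  -- otherwise the target grows, and it never exceeds `v`.
  reached : ∀ v → ∃ λ i → v ∈ L v i
  reached v = go v (distance [] v) 0 (λ ()) (m∸n≤m v (target [] v)) ≤-refl
    where
    go : ∀ f g i → v ∉ L v i → v ∸ target (L v i) v ≤ f → distance (L v i) v ≤ g → ∃ λ i → v ∈ L v i
    go f g i p hf hg with lem (v ∈ L v (suc i))
    ... | yes q = suc i , q
    ... | no q with lem (Reach (L v (suc i)) v (target (L v i) v))
    go f g i p hf hg | no q | yes m with closer (enterable v i p) (subst (λ as → Reach as v (target (L v i) v)) (L-out p) m)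
    go f zero i p hf hg | no q | yes m | _ , lt = ⊥-elim (<⇒≱ (<-≤-trans lt hg) z≤n)
    go f (suc g) i p hf hg | no q | yes m | same , lt = go f g (suc i) q
      (≤-trans (≤-reflexive (cong (v ∸_) (trans (cong (λ as → target as v) (L-out p)) same))) hf)
      (≤-trans (≤-reflexive (cong (λ as → distance as v) (L-out p))) (≤-pred (≤-trans lt hg)))
    go f g i p hf hg | no q | no ¬m = further f hf
      where
      t = target (L v i) v
      t′ = target (L v (suc i)) v
      t′-reach : Reach (L v (suc i)) v t′
      t′-reach = proj₁ (target-reach q)
      t<t′ : t < t′
      t<t′ = ≤∧≢⇒< (proj₂ (target-reach p) _ (reach-weaken L-suc t′-reach))
        (λ e → ¬m (subst (Reach (L v (suc i)) v) (sym e) t′-reach))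
      t′≤v : t′ ≤ v
      t′≤v = proj₂ (target-reach q) v (0 , stop q)
      lt : v ∸ t′ < v ∸ t
      lt = ∸-monoʳ-< t<t′ t′≤v
      further : ∀ f → v ∸ t ≤ f → ∃ λ i → v ∈ L v i
      further zero hf = ⊥-elim (<⇒≱ (<-≤-trans lt hf) z≤n)
      further (suc f) hf = go f (distance (L v (suc i)) v) (suc i) q (≤-pred (≤-trans lt hf)) ≤-refl

  -- The depth of `v` in the tree; `Up v` then lists its strict ancestors.
  τ : ℕ → ℕ
  τ v = μ (λ i → v ∈ L v (suc i))

  τ-least : ∀ v → Least (λ i → v ∈ L v (suc i)) (τ v)
  τ-least v = μ-Least (let (i , p) = reached v in i , L-suc p)

  Up : ℕ → List ℕ
  Up v = L v (τ v)

  self∉ : ∀ {v i} → i ≤ τ v → v ∉ L v i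
  self∉ {v} {zero} h ()
  self∉ {v} {suc i} h p = <⇒≱ h (proj₂ (τ-least v) i p)

  next-Up : ∀ v → next (Up v) v ≡ v
  next-Up v with subst (v ∈_) (L-out (self∉ {v} ≤-refl)) (proj₁ (τ-least v))
  ... | here e = sym e
  ... | there p = ⊥-elim (self∉ {v} ≤-refl p)

  τ-unique : ∀ {v i} → v ∉ L v i → next (L v i) v ≡ v → τ v ≡ i
  τ-unique {v} {i} p e with m≤n⇒m<n∨m≡n (proj₂ (τ-least v) i (subst (v ∈_) (sym (L-out p)) (here (sym e))))
  ... | inj₂ q = q
  ... | inj₁ lt = ⊥-elim (p (L-mono lt (proj₁ (τ-least v))))

  coherent : ∀ {u v} i → Reach (L v i) v u → ∀ {j} → j ≤ i → L u j ≡ L v j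
  coherent zero r z≤n = refl
  coherent {u} {v} (suc i) r {j} j≤ with m≤n⇒m<n∨m≡n j≤
  ... | inj₁ j<si = coherent i (reach-weaken L-suc r) (≤-pred j<si)
  ... | inj₂ refl = trans (L-out u∉) (trans (cong (λ as → next as u ∷ as) eq)
          (trans (cong (_∷ L v i) (sym (next-cong r′))) (sym (L-out v∉))))
    where
    r′ : Reach (L v i) v u
    r′ = reach-weaken L-suc r
    eq : L u i ≡ L v i
    eq = coherent i r′ ≤-refl
    v∉ : v ∉ L v i
    v∉ = walk-start (proj₂ r′)
    u∉ : u ∉ L u i
    u∉ = subst (u ∉_) (sym eq) (walk-end (proj₂ r′))

  infix 4 _⊑_
  _⊑_ : ℕ → ℕ → Set
  a ⊑ v = Reach (Up a) a v

  ⊑-refl : ∀ {v} → v ⊑ v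
  ⊑-refl {v} = 0 , stop (self∉ {v} ≤-refl)

  ⊑-prefix : ∀ {a v} → a ⊑ v → ∀ {j} → j ≤ τ a → L v j ≡ L a j
  ⊑-prefix {a} r = coherent (τ a) r

  ⊑-next : ∀ {a v} → a ⊑ v → next (L v (τ a)) v ≡ a
  ⊑-next {a} {v} r = trans (cong (λ as → next as v) (⊑-prefix r ≤-refl))
    (trans (sym (next-cong r)) (next-Up a))

  ⊑-out : ∀ {a v} → a ⊑ v → v ∉ L v (τ a)
  ⊑-out {a} {v} r = subst (v ∉_) (sym (⊑-prefix r ≤-refl)) (walk-end (proj₂ r))

  ⊑-τ : ∀ {a v} → a ⊑ v → a ≢ v → τ a < τ v
  ⊑-τ {a} {v} r a≢v with <-≤-connex (τ a) (τ v)
  ... | inj₁ lt = lt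
  ... | inj₂ ge with m≤n⇒m<n∨m≡n ge
  ...   | inj₁ lt = ⊥-elim (⊑-out r (L-mono lt (proj₁ (τ-least v))))
  ...   | inj₂ eq = ⊥-elim (a≢v (trans (sym (⊑-next r))
            (trans (cong (λ i → next (L v i) v) (sym eq)) (next-Up v))))

  ⊑-τ≤ : ∀ {a v} → a ⊑ v → τ a ≤ τ v
  ⊑-τ≤ {a} {v} r with a ≟ v
  ... | yes refl = ≤-refl
  ... | no a≢v = <⇒≤ (⊑-τ r a≢v)

  ⊑-antisym : ∀ {a b} → a ⊑ b → b ⊑ a → a ≡ b
  ⊑-antisym {a} {b} r s with a ≟ b
  ... | yes p = p
  ... | no p = ⊥-elim (<⇒≱ (⊑-τ r p) (⊑-τ≤ s))

  ⊑-member : ∀ {a v} → a ⊑ v → a ∈ v ∷ Up v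
  ⊑-member {a} {v} r with a ≟ v
  ... | yes p = here p
  ... | no p = there (L-mono (⊑-τ r p)
          (subst (a ∈_) (sym (L-out (⊑-out r))) (here (sym (⊑-next r)))))

  Up-shrink : ∀ {a b} → a ⊑ b → ∀ {x} → x ∈ Up a → x ∈ Up b
  Up-shrink {a} {b} r p = L-mono (⊑-τ≤ r) (subst (_ ∈_) (sym (⊑-prefix r ≤-refl)) p)

  ⊑-trans : ∀ {a b v} → a ⊑ b → b ⊑ v → a ⊑ v
  ⊑-trans r s = reach-trans r (reach-weaken (Up-shrink r) s)

  ⊑-chain′ : ∀ {a b v} → τ a ≤ τ b → a ⊑ v → b ⊑ v → a ⊑ b
  ⊑-chain′ {a} {b} {v} h r s = reach-trans r (reach-sym (reach-weaken shrink s))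
    where
    shrink : ∀ {x} → x ∈ Up a → x ∈ Up b
    shrink p = subst (_ ∈_) (⊑-prefix s ≤-refl)
      (L-mono h (subst (_ ∈_) (sym (⊑-prefix r ≤-refl)) p))

  abstract
    ⊑-chain : ∀ {a b v} → a ⊑ v → b ⊑ v → a ⊑ b ⊎ b ⊑ a
    ⊑-chain {a} {b} r s with ≤-total (τ a) (τ b)
    ... | inj₁ h = inj₁ (⊑-chain′ h r s)
    ... | inj₂ h = inj₂ (⊑-chain′ h s r)

  at : ℕ → ℕ → ℕ
  at v i = next (L v i) v

  at-entry : ∀ {v i} → v ∉ L v i → Entry (L v i) v (distance (L v i) v) (at v i)
  at-entry {v} {i} p = next-entry (enterable v i p)

  at-τ : ∀ {v i} → v ∉ L v i → τ (at v i) ≡ i × at v i ⊑ v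
  at-τ {v} {i} p = τ≡ , subst (λ as → Reach as r v) (sym (trans (cong (L r) τ≡) eq)) (reach-sym reach)
    where
    r = at v i
    reach : Reach (L v i) v r
    reach = proj₁ (proj₂ (at-entry {v} {i} p))
    eq : L r i ≡ L v i
    eq = coherent i reach ≤-refl
    τ≡ : τ r ≡ i
    τ≡ = τ-unique (subst (r ∉_) (sym eq) (walk-end (proj₂ reach)))
      (trans (cong (λ as → next as r) eq) (sym (next-cong reach)))

  L-ancestors : ∀ {u x} i → x ∈ L u i → τ x < i
  L-ancestors {u} {x} (suc i) p with lem (u ∈ L u i)
  ... | yes _ = m≤n⇒m≤1+n (L-ancestors i p)
  L-ancestors {u} {x} (suc i) (here refl) | no q = s≤s (≤-reflexive (proj₁ (at-τ q)))
  L-ancestors {u} {x} (suc i) (there p) | no q = m≤n⇒m≤1+n (L-ancestors i p)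

  -- All members of `Up u` have smaller depth than `u`, so `v` is not among them and the edge itself
  -- is a walk avoiding them.
  ⊑-edge′ : ∀ {u v} → A u v → τ u ≤ τ v → u ⊑ v
  ⊑-edge′ {u} {v} a h = 1 , step (self∉ {u} ≤-refl) a (stop λ p → <⇒≱ (L-ancestors (τ u) p) h)

  abstract
    ⊑-edge : ∀ {u v} → A u v → u ⊑ v ⊎ v ⊑ u
    ⊑-edge {u} {v} a with ≤-total (τ u) (τ v)
    ... | inj₁ h = inj₁ (⊑-edge′ a h)
    ... | inj₂ h = inj₂ (⊑-edge′ (A-sym a) h)

  list-bounded : ∀ (xs : List ℕ) → ∃ λ b → ∀ x → x ∈ xs → x < b
  list-bounded [] = 0 , λ _ ()
  list-bounded (y ∷ xs) with list-bounded xs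
  ... | b , h = suc y ⊔ b , go
    where
    go : ∀ x → x ∈ y ∷ xs → x < suc y ⊔ b
    go x (here refl) = m≤m⊔n (suc y) b
    go x (there p) = ≤-trans (h x p) (m≤n⊔m (suc y) b)

  abstract
    ⊑-bounded : ∀ v → Bounded (_⊑ v)
    ⊑-bounded v = let (b , h) = list-bounded (v ∷ Up v) in b , λ a r → h a (⊑-member r)

  at-cong : ∀ {a v i} → a ⊑ v → i ≤ τ a → at a i ≡ at v i
  at-cong {a} {v} {i} r h = trans (next-cong (reach-weaken (L-mono h) r))
    (cong (λ as → next as v) (sym (⊑-prefix r h)))

  at-edge : ∀ {v i} → suc i ≤ τ v → A (at v i) (at v (suc i))
  at-edge {v} {i} h = subst (λ as → AfterHead as (at v (suc i))) (L-out (self∉ (<⇒≤ h)))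
    (proj₁ (at-entry (self∉ h)))

  record RayIn (Y : ℕ → Set) : Set where
    field
      ρ : ℕ → ℕ
      ρ-injective : ∀ {i j} → ρ i ≡ ρ j → i ≡ j
      ρ-edge : ∀ i → A (ρ i) (ρ (suc i))
      ρ-often : Infinite (λ i → Y (ρ i))

  -- The ancestor paths of the `w i` extend one another and grow without bound, so their union is a
  -- ray; it passes through `w i` at position `τ (w i)`.
  chain-ray : ∀ {Y : ℕ → Set} (w : ℕ → ℕ) → (∀ i → Y (w i)) → (∀ i → w i ⊑ w (suc i) × w i ≢ w (suc i)) → RayIn Y
  chain-ray {Y} w Yw up = record
    { ρ = λ i → at (w i) i
    ; ρ-injective = λ {i} {j} e → trans (sym (proj₁ (at-τ (w∉ i)))) (trans (cong τ e) (proj₁ (at-τ (w∉ j))))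
    ; ρ-edge = λ i → subst (λ x → A x (at (w (suc i)) (suc i))) (sym (at-cong (proj₁ (up i)) (i≤τ i)))
        (at-edge (i≤τ (suc i)))
    ; ρ-often = λ i → τ (w i) , i≤τ i , subst Y (sym (hit i)) (Yw i) }
    where
    i≤τ : ∀ i → i ≤ τ (w i)
    i≤τ zero = z≤n
    i≤τ (suc i) = ≤-trans (s≤s (i≤τ i)) (⊑-τ (proj₁ (up i)) (proj₂ (up i)))
    w∉ : ∀ i → w i ∉ L (w i) i
    w∉ i = self∉ (i≤τ i)
    mono-w : ∀ {i j} → i ≤′ j → w i ⊑ w j
    mono-w ≤′-refl = ⊑-refl
    mono-w (≤′-step {j} h) = ⊑-trans (mono-w h) (proj₁ (up j))
    hit : ∀ i → at (w (τ (w i))) (τ (w i)) ≡ w i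
    hit i = trans (sym (at-cong (mono-w (≤⇒≤′ (i≤τ i))) ≤-refl)) (next-Up (w i))

  Above : (ℕ → Set) → ℕ → ℕ → Set
  Above Y v u = (u ⊑ v × u ≢ v) × Y v

  above-accessible : ∀ {Y : ℕ → Set} → ¬ RayIn Y → ∀ y → Y y → Acc (Above Y) y
  above-accessible {Y} noRay y Yy with lem (Acc (Above Y) y)
  ... | yes a = a
  ... | no ¬a = ⊥-elim (noRay (chain-ray (λ i → proj₁ (w i)) (λ i → proj₁ (proj₂ (w i)))
          (λ i → proj₁ (proj₂ (bad (w i))))))
    where
    Bad : Set
    Bad = ∃ λ v → Y v × ¬ Acc (Above Y) v
    bad : (b : Bad) → ∃ λ v → (proj₁ b ⊑ v × proj₁ b ≢ v) × Y v × ¬ Acc (Above Y) v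
    bad (u , Yu , ¬u) = by-contradiction λ h → ¬u (acc λ {v} (p , Yv) →
      by-contradiction λ ¬v → h (v , p , Yv , ¬v))
    w : ℕ → Bad
    w zero = y , Yy , ¬a
    w (suc i) = let (v , _ , Yv , ¬v) = bad (w i) in v , Yv , ¬v

-- Ordinal ranks and a recurrent schedule.

data Tree : Set where
  leaf : Tree
  node : (ℕ → Tree) → Tree

infix 4 _≤ᵗ_ _<ᵗ_
-- Trees as ordinals: `node f` stands for the supremum of the successors of the `f n`.
_≤ᵗ_ _<ᵗ_ : Tree → Tree → Set
leaf ≤ᵗ t = ⊤
node f ≤ᵗ t = ∀ n → f n <ᵗ t
s <ᵗ leaf = ⊥
s <ᵗ node g = ∃ λ n → s ≤ᵗ g n

mutual
  ≤ᵗ-trans : ∀ r s t → r ≤ᵗ s → s ≤ᵗ t → r ≤ᵗ t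
  ≤ᵗ-trans leaf s t p q = tt
  ≤ᵗ-trans (node f) s t p q n = <ᵗ-≤ᵗ-trans (f n) s t (p n) q

  <ᵗ-≤ᵗ-trans : ∀ r s t → r <ᵗ s → s ≤ᵗ t → r <ᵗ t
  <ᵗ-≤ᵗ-trans r (node g) t (n , p) q = ≤ᵗ-<ᵗ-trans r (g n) t p (q n)

  ≤ᵗ-<ᵗ-trans : ∀ r s t → r ≤ᵗ s → s <ᵗ t → r <ᵗ t
  ≤ᵗ-<ᵗ-trans r s (node h) p (n , q) = n , ≤ᵗ-trans r s (h n) p q

≤ᵗ-refl : ∀ t → t ≤ᵗ t
≤ᵗ-refl leaf = tt
≤ᵗ-refl (node f) n = n , ≤ᵗ-refl (f n)

<ᵗ-accessible : ∀ t → Acc _<ᵗ_ t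
<ᵗ-accessible t = acc (below t)
  where
  below : ∀ t {s} → s <ᵗ t → Acc _<ᵗ_ s
  below (node g) {s} (n , p) = acc λ {r} q → below (g n) (<ᵗ-≤ᵗ-trans r s (g n) q p)

-- The second component remembers the last restart. The first runs through 0, 1, 0, 2, 1, 0, 3 and
-- so on, so every number recurs.
countdown : ℕ → ℕ × ℕ
countdown zero = 0 , 0
countdown (suc n) with countdown n
... | suc i , b = i , b
... | zero , b = suc b , suc b

countdown-reaches : ∀ z i n {b} → countdown n ≡ (i , b) → z ≤ i → ∃ λ m → n ≤ m × countdown m ≡ (z , b)
countdown-reaches z i n e z≤i with m≤n⇒m<n∨m≡n z≤i
countdown-reaches z i n e z≤i | inj₂ refl = n , ≤-refl , e
countdown-reaches z (suc i) n {b} e _ | inj₁ z<i with countdown-reaches z i (suc n) next (≤-pred z<i)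
  where
  next : countdown (suc n) ≡ (i , b)
  next rewrite e = refl
... | m , n<m , e′ = m , <⇒≤ n<m , e′

countdown-large : ∀ n b → ∃ λ m → n ≤ m × ∃ λ b′ → b ≤ b′ × countdown m ≡ (b′ , b′)
countdown-large n b = go b
  where
  restart : ∀ n → ∃ λ m → n ≤ m × ∃ λ b′ → suc (proj₂ (countdown n)) ≡ b′ × countdown m ≡ (b′ , b′)
  restart n with countdown n in e
  ... | i , b with countdown-reaches 0 i n e z≤n
  ...   | m , n≤m , e′ = suc m , m≤n⇒m≤1+n n≤m , suc b , refl , next
    where
    next : countdown (suc m) ≡ (suc b , suc b)
    next rewrite e′ = refl
  go : ∀ b → ∃ λ m → n ≤ m × ∃ λ b′ → b ≤ b′ × countdown m ≡ (b′ , b′)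
  go zero = let (m , n≤m , b′ , _ , e) = restart n in m , n≤m , b′ , z≤n , e
  go (suc b) with go b
  ... | m , n≤m , b′ , b≤b′ , e with restart m
  ...   | m′ , m≤m′ , b″ , s , e′ = m′ , ≤-trans n≤m m≤m′ , b″ ,
            ≤-trans (s≤s b≤b′) (≤-reflexive (trans (cong (suc ∘ proj₂) (sym e)) s)) , e′

task : ℕ → ℕ
task n = proj₁ (countdown n)

task-infinite : ∀ z → Infinite (λ n → task n ≡ z)
task-infinite z n with countdown-large n z
... | m , n≤m , b , z≤b , e with countdown-reaches z b m e z≤b
...   | m′ , m≤m′ , e′ = m′ , ≤-trans n≤m m≤m′ , cong proj₁ e′

-- Private children.

module Selection (lem : LEM) (A : ℕ → ℕ → Set) where

  open Classical lem

  -- `lo ≤ y` keeps the choices distinct, so that a child has one parent; `n ≤ y` makes the children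
  -- of a vertex unbounded; `task n < y` puts parents below their children.
  Candidate : ℕ → ℕ → ℕ → Set
  Candidate n lo y = (lo ≤ y × n ≤ y × task n < y) × A (task n) y

  choose : ℕ → ℕ → Maybe ℕ
  choose n lo with lem (∃ (Candidate n lo))
  ... | yes (y , _) = just y
  ... | no _ = nothing

  choose-candidate : ∀ n lo {y} → choose n lo ≡ just y → Candidate n lo y
  choose-candidate n lo e with lem (∃ (Candidate n lo))
  choose-candidate n lo refl | yes (y , p) = p
  choose-candidate n lo () | no _

  choose-exists : ∀ n lo → ∃ (Candidate n lo) → ∃ λ y → choose n lo ≡ just y
  choose-exists n lo h with lem (∃ (Candidate n lo))
  ... | yes (y , _) = y , refl
  ... | no k = ⊥-elim (k h)

  advance : Maybe ℕ → ℕ → ℕ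
  advance (just y) lo = suc y
  advance nothing lo = lo

  low : ℕ → ℕ
  low zero = 0
  low (suc n) = advance (choose n (low n)) (low n)

  chosen : ℕ → Maybe ℕ
  chosen n = choose n (low n)

  low-step : ∀ n → low n ≤ low (suc n)
  low-step n with chosen n in e
  ... | nothing = ≤-refl
  ... | just y = m≤n⇒m≤1+n (proj₁ (proj₁ (choose-candidate n (low n) e)))

  low-mono : ∀ {m n} → m ≤′ n → low m ≤ low n
  low-mono ≤′-refl = ≤-refl
  low-mono (≤′-step {n} h) = ≤-trans (low-mono h) (low-step n)

  chosen-increasing : ∀ {m n x y} → m < n → chosen m ≡ just x → chosen n ≡ just y → x < y
  chosen-increasing {m} {n} {x} {y} m<n p q = begin-strict
    x           <⟨ n<1+n x ⟩
    suc x       ≡⟨ cong (λ z → advance z (low m)) p ⟨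
    low (suc m) ≤⟨ low-mono (≤⇒≤′ m<n) ⟩
    low n       ≤⟨ proj₁ (proj₁ (choose-candidate n (low n) q)) ⟩
    y           ∎
    where open ≤-Reasoning

  chosen-injective : ∀ {m n y} → chosen m ≡ just y → chosen n ≡ just y → m ≡ n
  chosen-injective {m} {n} p q with <-≤-connex m n
  ... | inj₁ m<n = ⊥-elim (<-irrefl refl (chosen-increasing m<n p q))
  ... | inj₂ n≤m with m≤n⇒m<n∨m≡n n≤m
  ...   | inj₁ n<m = ⊥-elim (<-irrefl refl (chosen-increasing n<m q p))
  ...   | inj₂ e = sym e

  abstract
    parent : ℕ → Maybe ℕ
    parent y with lem (∃ λ n → chosen n ≡ just y)
    ... | yes (n , _) = just (task n)
    ... | no _ = nothing

    parent-sound : ∀ y z → parent y ≡ just z → z < y × A z y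
    parent-sound y z e with lem (∃ λ n → chosen n ≡ just y)
    parent-sound y z refl | yes (n , p) =
      let ((_ , _ , lt) , a) = choose-candidate n (low n) p in lt , a
    parent-sound y z () | no _

    parent-infinite : ∀ z → Infinite (A z) → Infinite (λ y → parent y ≡ just z)
    parent-infinite z I k with task-infinite z k
    ... | n , k≤n , refl with I (low n ⊔ (n ⊔ suc z))
    ...   | y , h , a with choose-exists n (low n)
              (y , (≤-trans (m≤m⊔n (low n) _) h ,
                    ≤-trans (≤-trans (m≤m⊔n n (suc z)) (m≤n⊔m (low n) _)) h ,
                    ≤-trans (≤-trans (m≤n⊔m n (suc z)) (m≤n⊔m (low n) _)) h) , a)
    ...     | x , e = x , ≤-trans k≤n (proj₁ (proj₂ (proj₁ (choose-candidate n (low n) e)))) , found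
      where
      found : parent x ≡ just (task n)
      found with lem (∃ λ m → chosen m ≡ just x)
      ... | yes (m , p) = cong (just ∘ task) (chosen-injective p e)
      ... | no h = ⊥-elim (h (n , e))

-- The classes `F`, `W`, `X` and the graph `H`.

module Preparation (lem : LEM) (adj : ℕ → ℕ → Bool)
  (adj-sym : ∀ i j → adj i j ≡ true → adj j i ≡ true) where

  open Classical lem

  Adj : ℕ → ℕ → Set
  Adj i j = adj i j ≡ true

  F : ℕ → Set
  F v = Bounded (Adj v)

  ManyF : ℕ → Set
  ManyF v = Infinite (λ u → F u × Adj v u)

  -- Inductive, so that every derivation has a well-founded rank. The unbounded sequence `s` encodes
  -- infinitely many neighbours and provides the branches of the rank tree.
  data W (v : ℕ) : Set where
    base : ManyF v → W v
    step : (s : ℕ → ℕ) → (∀ n → n ≤ s n × Adj v (s n)) → (∀ n → W (s n)) → W v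

  -- Every vertex of X has infinitely many neighbours in X, so that X can be coloured on its own.
  X : ℕ → Set
  X v = ¬ F v × ¬ W v

  W⇒¬F : ∀ {v} → W v → ¬ F v
  W⇒¬F (base I) = infinite¬bounded (infinite-map (λ _ → proj₂) I)
  W⇒¬F (step s p _) = infinite¬bounded (λ n → s n , p n)

  -- By `base` and `step`, infinitely many neighbours in `F` or in `W` would put `v` into `W`; hence
  -- all but finitely many neighbours lie in `X`.
  X-infinite : ∀ v → X v → Infinite (λ u → Adj v u × X u)
  X-infinite v (¬f , ¬w) with
      ¬infinite⇒bounded {λ u → F u × Adj v u} (¬w ∘ base)
    | ¬infinite⇒bounded {λ u → Adj v u × W u}
        (λ I → ¬w (step (proj₁ ∘ I) (λ n → let (_ , l , a , _) = I n in l , a)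
          (λ n → let (_ , _ , _ , w) = I n in w)))
  ... | b , hb | b′ , hb′ = λ n →
    let (u , l , a) = ¬bounded⇒infinite ¬f (n ⊔ (b ⊔ b′)) in
    u , ≤-trans (m≤m⊔n n _) l , a ,
    (λ f → <⇒≱ (hb u (f , a)) (≤-trans (m≤m⊔n b b′) (≤-trans (m≤n⊔m n _) l))) ,
    (λ w → <⇒≱ (hb′ u (a , w)) (≤-trans (m≤n⊔m b b′) (≤-trans (m≤n⊔m n _) l)))

  rank : ∀ {v} → W v → Tree
  rank (base _) = leaf
  rank (step s _ w) = node (λ n → rank (w n))

  mutual
    ≤ᵗ-total : ∀ s t → s ≤ᵗ t ⊎ t <ᵗ s
    ≤ᵗ-total leaf t = inj₁ tt
    ≤ᵗ-total (node f) t with lem (∃ λ n → ¬ f n <ᵗ t)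
    ... | yes (n , h) = inj₂ (n , ≮ᵗ⇒≥ᵗ (f n) t h)
    ... | no h = inj₁ λ n → by-contradiction λ k → h (n , k)

    ≮ᵗ⇒≥ᵗ : ∀ s t → ¬ s <ᵗ t → t ≤ᵗ s
    ≮ᵗ⇒≥ᵗ s leaf h = tt
    ≮ᵗ⇒≥ᵗ s (node g) h m with ≤ᵗ-total s (g m)
    ... | inj₁ p = ⊥-elim (h (m , p))
    ... | inj₂ p = p

  rank-minimal : ∀ {v} → W v → ∃ λ (w : W v) → ∀ (w′ : W v) → rank w ≤ᵗ rank w′
  rank-minimal {v} w = go w (<ᵗ-accessible (rank w))
    where
    go : (w : W v) → Acc _<ᵗ_ (rank w) → ∃ λ (w : W v) → ∀ (w′ : W v) → rank w ≤ᵗ rank w′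
    go w (acc rs) with lem (∃ λ w′ → rank w′ <ᵗ rank w)
    ... | yes (w′ , lt) = go w′ (rs lt)
    ... | no h = w , λ w′ → ≮ᵗ⇒≥ᵗ (rank w′) (rank w) (λ lt → h (w′ , lt))

  infix 4 _≺_
  -- A vertex may have derivations of different ranks; for `v` in `W`, this compares the least ones.
  _≺_ : ℕ → ℕ → Set
  u ≺ v = ∃ λ (w : W u) → ∀ (w′ : W v) → rank w <ᵗ rank w′

  ≺-accessible : ∀ {v} (w : W v) → Acc _<ᵗ_ (rank w) → Acc _≺_ v
  ≺-accessible w (acc rs) = acc λ (w′ , h) → ≺-accessible w′ (rs (h w))

  ≺-infinite : ∀ v → W v → ¬ ManyF v → Infinite (λ u → Adj v u × u ≺ v)
  ≺-infinite v w ¬I with rank-minimal w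
  ... | base I , _ = ⊥-elim (¬I I)
  ... | step s p ws , min = λ n → s n , proj₁ (p n) , proj₂ (p n) , ws n ,
          λ w′ → <ᵗ-≤ᵗ-trans (rank (ws n)) (node (λ n → rank (ws n))) (rank w′) (n , ≤ᵗ-refl _) (min w′)

  Child : ℕ → ℕ → Set
  Child z y = (X z × X y × Adj z y) ⊎ (W z × ¬ ManyF z × Adj z y × y ≺ z)

  open Selection lem Child public using (parent; parent-sound; parent-infinite)

  parent-X : ∀ v → X v → Infinite (λ y → parent y ≡ just v)
  parent-X v x = parent-infinite v (infinite-map (λ y (a , x′) → inj₁ (x , x′ , a)) (X-infinite v x))

  parent-W : ∀ v → W v → ¬ ManyF v → Infinite (λ y → parent y ≡ just v)
  parent-W v w ¬I = parent-infinite v (infinite-map (λ y (a , lt) → inj₂ (w , ¬I , a , lt)) (≺-infinite v w ¬I))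

  child-X : ∀ {v y} → X v → parent y ≡ just v → Adj v y × X y
  child-X {v} {y} x e with proj₂ (parent-sound y v e)
  ... | inj₁ (_ , x′ , a) = a , x′
  ... | inj₂ (w , _) = ⊥-elim (proj₂ x w)

  child-W : ∀ {v y} → W v → parent y ≡ just v → Adj v y × y ≺ v
  child-W {v} {y} w e with proj₂ (parent-sound y v e)
  ... | inj₁ (x , _) = ⊥-elim (proj₂ x w)
  ... | inj₂ (_ , _ , a , lt) = a , lt

  -- Colours alternate along parent edges. The argument `k` is fuel, sufficient when `y < k` because
  -- parents decrease.
  paint : ℕ → Colouring
  paint zero y = false
  paint (suc k) y with parent y
  ... | nothing = false
  ... | just z = not (paint k z)

  paint-stable : ∀ k l y → y < k → y < l → paint k y ≡ paint l y
  paint-stable (suc k) (suc l) y p q with parent y in e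
  ... | nothing = refl
  ... | just z = let z<y = proj₁ (parent-sound y z e) in
        cong not (paint-stable k l z (<-≤-trans z<y (≤-pred p)) (<-≤-trans z<y (≤-pred q)))

  abstract
    cX : Colouring
    cX y = paint (suc y) y

    cX-parent : ∀ {y z} → parent y ≡ just z → cX y ≡ not (cX z)
    cX-parent {y} {z} e with parent y in e′
    cX-parent {y} {z} refl | just z = cong not (paint-stable y (suc z) z (proj₁ (parent-sound y z e′)) ≤-refl)

  record H (u v : ℕ) : Set where
    constructor edge
    field
      adjacent : Adj u v
      ¬Xˡ : ¬ X u
      ¬Xʳ : ¬ X v
      kind : F u ⊎ F v ⊎ parent u ≡ just v ⊎ parent v ≡ just u

  open H public

  H-sym : ∀ {u v} → H u v → H v u
  H-sym (edge a x y (inj₁ f)) = edge (adj-sym _ _ a) y x (inj₂ (inj₁ f))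
  H-sym (edge a x y (inj₂ (inj₁ f))) = edge (adj-sym _ _ a) y x (inj₁ f)
  H-sym (edge a x y (inj₂ (inj₂ (inj₁ p)))) = edge (adj-sym _ _ a) y x (inj₂ (inj₂ (inj₂ p)))
  H-sym (edge a x y (inj₂ (inj₂ (inj₂ p)))) = edge (adj-sym _ _ a) y x (inj₂ (inj₂ (inj₁ p)))

  module _ (ρ : ℕ → ℕ) (ρ-injective : ∀ {i j} → ρ i ≡ ρ j → i ≡ j)
    (ρ-edge : ∀ i → H (ρ i) (ρ (suc i))) where

    Rise Fall : ℕ → Set
    Rise i = parent (ρ i) ≡ just (ρ (suc i))
    Fall i = parent (ρ (suc i)) ≡ just (ρ i)

    module _ (b : ℕ) (noF : ∀ i → b ≤ i → ¬ F (ρ i)) where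

      rise-or-fall : ∀ i → b ≤ i → Rise i ⊎ Fall i
      rise-or-fall i h with kind (ρ-edge i)
      ... | inj₁ f = ⊥-elim (noF i h f)
      ... | inj₂ (inj₁ f) = ⊥-elim (noF (suc i) (m≤n⇒m≤1+n h) f)
      ... | inj₂ (inj₂ p) = p

      ranked : ∀ i → b ≤ i → W (ρ i)
      ranked i h = by-contradiction λ ¬w → ¬Xˡ (ρ-edge i) (noF i h , ¬w)

      -- A rise straight after a fall would return to the unique parent just left, against
      -- injectivity.
      fall-persists : ∀ i → b ≤ i → Fall i → Fall (suc i)
      fall-persists i h f with rise-or-fall (suc i) (m≤n⇒m≤1+n h)
      ... | inj₂ f′ = f′
      ... | inj₁ r with ρ-injective {i} {suc (suc i)} (just-injective (trans (sym f) r))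
      ...   | ()

      no-fall : ∀ i → b ≤ i → ¬ Fall i
      no-fall i h f = go i h f (≺-accessible (ranked i h) (<ᵗ-accessible _))
        where
        go : ∀ i → b ≤ i → Fall i → ¬ Acc _≺_ (ρ i)
        go i h f (acc rs) = go (suc i) (m≤n⇒m≤1+n h) (fall-persists i h f)
          (rs (proj₂ (child-W (ranked i h) f)))

      -- A fall would start an infinite descent in rank, so every step goes to the parent, whose
      -- number is smaller.
      no-tail : ⊥
      no-tail = descend (ρ b) b ≤-refl ≤-refl
        where
        descend : ∀ k i → b ≤ i → ρ i ≤ k → ⊥
        descend k i h le with rise-or-fall i h
        ... | inj₂ f = no-fall i h f
        descend zero i h le | inj₁ r = <⇒≱ (proj₁ (parent-sound _ _ r)) (≤-trans le z≤n)
        descend (suc k) i h le | inj₁ r =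
          descend k (suc i) (m≤n⇒m≤1+n h) (≤-pred (≤-trans (proj₁ (parent-sound _ _ r)) le))

    F-often : Infinite (λ i → F (ρ i))
    F-often = by-contradiction λ h → let (b , q) = ¬infinite⇒bounded h in
      no-tail b λ i b≤i f → <⇒≱ (q i f) b≤i

-- Comparing sets by counting.

∧-true : ∀ {a b} → a ∧ b ≡ true → a ≡ true × b ≡ true
∧-true {true} {true} _ = refl , refl

count : (ℕ → Bool) → ℕ → ℕ
count p n = sum n (𝟙 ∘ p)

count-mono : ∀ p {m n} → m ≤′ n → count p m ≤ count p n
count-mono p ≤′-refl = ≤-refl
count-mono p (≤′-step h) = ≤-trans (count-mono p h) (m≤m+n _ _)

count-suc : ∀ p n → p n ≡ true → count p (suc n) ≡ suc (count p n)
count-suc p n h rewrite h = +-comm (count p n) 1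

count-infinite : ∀ p → Infinite (λ n → p n ≡ true) → ∀ k → ∃ λ n → k ≤ count p n
count-infinite p I zero = 0 , z≤n
count-infinite p I (suc k) with count-infinite p I k
... | n , le with I n
...   | m , n≤m , h = suc m , ≤-trans (s≤s (≤-trans le (count-mono p (≤⇒≤′ n≤m))))
        (≤-reflexive (sym (count-suc p m h)))

count-hits : ∀ p n k → k < count p n → ∃ λ i → p i ≡ true × count p i ≡ k
count-hits p (suc n) k h with p n in e
... | false = count-hits p n k (subst (k <_) (+-identityʳ _) h)
... | true with m≤n⇒m<n∨m≡n (≤-pred (subst (k <_) (+-comm _ 1) h))
...   | inj₁ lt = count-hits p n k lt
...   | inj₂ refl = n , e , refl

count-injective : ∀ p i j → p i ≡ true → p j ≡ true → count p i ≡ count p j → i ≡ j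
count-injective p i j hi hj eq with <-≤-connex i j
... | inj₁ i<j = ⊥-elim (1+n≰n (≤-trans (≤-reflexive (sym (count-suc p i hi)))
        (≤-trans (count-mono p (≤⇒≤′ i<j)) (≤-reflexive (sym eq)))))
... | inj₂ j≤i with m≤n⇒m<n∨m≡n j≤i
...   | inj₁ j<i = ⊥-elim (1+n≰n (≤-trans (≤-reflexive (sym (count-suc p j hj)))
        (≤-trans (count-mono p (≤⇒≤′ j<i)) (≤-reflexive eq))))
...   | inj₂ e = sym e

-- The `k`-th element of `p` goes to the `k`-th element of `q`, which treats finite and infinite
-- sets alike.
count-embed : ∀ p q → (∀ n → ∃ λ m → count p n ≤ count q m) →
  ∃ λ (f : ∀ i → p i ≡ true → ℕ) → (∀ i h → q (f i h) ≡ true) ×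
    (∀ i j h k → f i h ≡ f j k → i ≡ j)
count-embed p q dom = (λ i h → proj₁ (image i h)) , (λ i h → proj₁ (proj₂ (image i h))) ,
  λ i j h k e → count-injective p i j h k
    (trans (sym (proj₂ (proj₂ (image i h)))) (trans (cong (count q) e) (proj₂ (proj₂ (image j k)))))
  where
  image : ∀ i → p i ≡ true → ∃ λ j → q j ≡ true × count q j ≡ count p i
  image i h = let (m , le) = dom (suc i) in
    count-hits q m (count p i) (≤-trans (≤-reflexive (sym (count-suc p i h))) le)

sum-change : ∀ n v (f g : ℕ → ℕ) a b → v < n → (∀ j → j ≢ v → f j ≡ g j) → f v + a ≡ g v + b →
  sum n f + a ≡ sum n g + b
sum-change (suc n) v f g a b v<sn same eq with m≤n⇒m<n∨m≡n (≤-pred v<sn)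
... | inj₂ refl = trans (+-assoc (sum n f) (f n) a)
      (trans (cong₂ _+_ (sum-cong n (λ i i<n → same i λ { refl → <-irrefl refl i<n })) eq)
        (sym (+-assoc (sum n g) (g n) b)))
... | inj₁ v<n = trans (xy∙z≈xz∙y (sum n f) (f n) a)
      (trans (cong₂ _+_ (sum-change n v f g a b v<n same eq) (same n λ { refl → <-irrefl refl v<n }))
        (sym (xy∙z≈xz∙y (sum n g) (g n) b)))

agree-sym : ∀ x y → agree x y ≡ agree y x
agree-sym true true = refl
agree-sym true false = refl
agree-sym false true = refl
agree-sym false false = refl

true-iff : ∀ {x y} → (x ≡ true → y ≡ true) → (y ≡ true → x ≡ true) → x ≡ y
true-iff {true} f g = sym (f refl)
true-iff {false} {false} f g = refl
true-iff {false} {true} f g = g refl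

-- Making the vertices of `W` happy.

module Assembly (lem : LEM) (adj : ℕ → ℕ → Bool)
  (adj-sym : ∀ i j → adj i j ≡ true → adj j i ≡ true) where

  open Classical lem
  open Preparation lem adj adj-sym

  abstract
    e : ℕ → ℕ → Bool
    e i j = adj i j ∧ (⟪ F i ⟫ ∨ ⟪ F j ⟫)

    e-Adj : ∀ i j → e i j ≡ true → Adj i j
    e-Adj i j h = proj₁ (∧-true h)

    e-F : ∀ i j → e i j ≡ true → F i ⊎ F j
    e-F i j h = go _ _ refl refl (proj₂ (∧-true {adj i j} h))
      where
      go : ∀ a b → ⟪ F i ⟫ ≡ a → ⟪ F j ⟫ ≡ b → a ∨ b ≡ true → F i ⊎ F j
      go true b p _ _ = inj₁ (⟪⟫-elim p)
      go false true _ p _ = inj₂ (⟪⟫-elim p)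

    F-e : ∀ {i} j → F i → e i j ≡ adj i j
    F-e {i} j f = trans (cong (λ b → adj i j ∧ (b ∨ ⟪ F j ⟫)) (⟪⟫-intro f)) (Bool.∧-identityʳ (adj i j))

    e-sym : ∀ i j → e i j ≡ true → e j i ≡ true
    e-sym i j h with e-F i j h
    ... | inj₂ f = trans (F-e i f) (adj-sym i j (e-Adj i j h))
    ... | inj₁ f = trans (cong (λ b → adj j i ∧ (⟪ F j ⟫ ∨ b)) (⟪⟫-intro f))
          (trans (cong (adj j i ∧_) (Bool.∨-zeroʳ ⟪ F j ⟫))
            (trans (Bool.∧-identityʳ (adj j i)) (adj-sym i j (e-Adj i j h))))

  F-bounded : ∀ v → F v → Bounded (λ u → e v u ≡ true)
  F-bounded v (b , h) = b , λ u p → h u (e-Adj v u p)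

  open Cuts lem e e-sym F X (λ _ → proj₁) cX F-bounded
  open NormalTree lem H H-sym

  -- The neighbours that are used to make a vertex of infinite degree happy.
  Care : ℕ → ℕ → Set
  Care y u = (ManyF y × F u × Adj y u) ⊎ (¬ ManyF y × parent u ≡ just y)

  Happy : Colouring → ℕ → Set
  Happy c y = Infinite (λ u → Care y u × c u ≢ c y)

  W⇒¬X : ∀ {v} → W v → ¬ X v
  W⇒¬X w x = proj₂ x w

  F⇒¬X : ∀ {v} → F v → ¬ X v
  F⇒¬X f x = proj₁ x f

  care-infinite : ∀ y → W y → Infinite (Care y)
  care-infinite y w with lem (ManyF y)
  ... | yes I = infinite-map (λ u (f , a) → inj₁ (I , f , a)) I
  ... | no ¬I = infinite-map (λ u p → inj₂ (¬I , p)) (parent-W y w ¬I)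

  care-H : ∀ {y u} → W y → Care y u → H y u
  care-H w (inj₁ (_ , f , a)) = edge a (W⇒¬X w) (F⇒¬X f) (inj₂ (inj₁ f))
  care-H w (inj₂ (_ , p)) = let (a , w′ , _) = child-W w p in
    edge a (W⇒¬X w) (W⇒¬X w′) (inj₂ (inj₂ (inj₂ p)))

  care-Adj : ∀ {y u} → W y → Care y u → Adj y u
  care-Adj w p = adjacent (care-H w p)

  happy-transfer : ∀ {c d y} → c y ≡ d y → Eventually (λ u → Care y u → c u ≡ d u) → Happy c y → Happy d y
  happy-transfer {c} {d} eq (b , same) I n with I (n ⊔ b)
  ... | u , h , care , opp = u , ≤-trans (m≤m⊔n n b) h , care ,
        λ p → opp (trans (same u (≤-trans (m≤n⊔m n b) h) care) (trans p (sym eq)))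

  finDiff-tail : ∀ {c d} → (fd : FinDiff c d) → ∀ u → proj₁ fd ≤ u → c u ≡ d u
  finDiff-tail {c} {d} (n , h) u n≤u with c u Bool.≟ d u
  ... | yes p = p
  ... | no p = ⊥-elim (<⇒≱ (proj₂ (h u p)) n≤u)

  -- All neighbours of `y` along `e` lie in `F`. If they are infinitely many, they are the ones `y`
  -- cares for; otherwise their finiteness gives the bound.
  few-foes : ∀ {c : Colouring} {y b} → W y → (∀ u → Care y u × c u ≢ c y → u < b) →
    Bounded (λ u → e u y ≡ true × c u ≢ c y)
  few-foes {c} {y} {b} w opp = go (lem (ManyF y))
    where
    neighbour-F : ∀ u → e u y ≡ true → F u
    neighbour-F u h with e-F u y h
    ... | inj₁ f = f
    ... | inj₂ f = ⊥-elim (W⇒¬F w f)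
    go : Dec (ManyF y) → Bounded (λ u → e u y ≡ true × c u ≢ c y)
    go (yes I) = b , λ u (h , p) → opp u (inj₁ (I , neighbour-F u h , adj-sym u y (e-Adj u y h)) , p)
    go (no ¬I) = let (b′ , q) = ¬infinite⇒bounded ¬I in
      b′ , λ u (h , p) → q u (neighbour-F u h , adj-sym u y (e-Adj u y h))

  Repaired : Colouring → ℕ → Set
  Repaired c y = ∃ λ d → Optimal d × Happy d y × (∀ x → W x → Happy c x → Happy d x)

  -- Almost all vertices that `y` cares for had its old colour and so oppose its new one. Other
  -- vertices of `W` see only finitely many changes.
  flipped-happy : ∀ {c y b} → W y → (∀ u → Care y u × c u ≢ c y → u < b) →
    (∃ λ d → Optimal d × FinDiff (flip y c) d) → Repaired c y
  flipped-happy {c} {y} {b} w opp (d , opt , fd) = d , opt , happy , others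
    where
    N₀ : ℕ
    N₀ = proj₁ fd ⊔ suc y
    tail : ∀ u → N₀ ≤ u → c u ≡ d u
    tail u h = trans (sym (≔-other c _ (λ { refl → <⇒≱ (m≤n⊔m (proj₁ fd) (suc u)) h })))
      (finDiff-tail fd u (≤-trans (m≤m⊔n (proj₁ fd) (suc y)) h))
    dy : d y ≡ not (c y)
    dy = trans (sym (finDiff-outside fd (W⇒¬F w))) (≔-same c y _)
    happy : Happy d y
    happy n with care-infinite y w (n ⊔ (b ⊔ N₀))
    ... | u , h , care = u , ≤-trans (m≤m⊔n n _) h , care , λ p → Bool.not-¬ refl (sym (trans (sym dy) (trans (sym p) du)))
      where
      cu : c u ≡ c y
      cu with c u Bool.≟ c y
      ... | yes p = p
      ... | no p = ⊥-elim (<⇒≱ (opp u (care , p)) (≤-trans (m≤m⊔n b N₀) (≤-trans (m≤n⊔m n _) h)))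
      du : d u ≡ c y
      du = trans (sym (tail u (≤-trans (m≤n⊔m b N₀) (≤-trans (m≤n⊔m n _) h)))) cu
    others : ∀ x → W x → Happy c x → Happy d x
    others x wx h with x ≟ y
    ... | yes refl = happy
    ... | no x≢y = happy-transfer
      (trans (sym (≔-other c _ x≢y)) (finDiff-outside fd (W⇒¬F wx))) (N₀ , λ u p _ → tail u p) h

  repair : ∀ {c y} → Optimal c → W y → Repaired c y
  repair {c} {y} opt w = go (lem (Happy c y))
    where
    go : Dec (Happy c y) → Repaired c y
    go (yes h) = c , opt , h , λ _ _ h′ → h′
    go (no ¬h) = let (b , opp) = ¬infinite⇒bounded ¬h in
      flipped-happy {c} w opp (flip-repair {c} opt (W⇒¬F w) (W⇒¬X w) (few-foes {c} w opp))

  -- Preserving the vertices that are already happy is what allows improvements to be iterated.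
  record Good (P : ℕ → Set) : Set where
    constructor good
    field
      improve : ∀ c → Optimal c → ∃ λ d → Optimal d × (∀ y → W y → P y ⊎ Happy c y → Happy d y)

  open Good

  good-below : ∀ s → Good (_< s)
  good-below zero = good λ c opt → c , opt , λ { y w (inj₁ ()) ; y w (inj₂ h) → h }
  good-below (suc s) = good λ c opt → more c (lem (W s)) (improve (good-below s) c opt)
    where
    more : ∀ c → Dec (W s) → (∃ λ d → Optimal d × (∀ y → W y → y < s ⊎ Happy c y → Happy d y)) →
      ∃ λ d → Optimal d × (∀ y → W y → y < suc s ⊎ Happy c y → Happy d y)
    more c (no ¬w) (d , opt′ , h) = d , opt′ , λ
          { y w (inj₁ y≤s) → h y w (inj₁ (≤∧≢⇒< (≤-pred y≤s) λ { refl → ¬w w }))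
          ; y w (inj₂ p) → h y w (inj₂ p) }
    more c (yes ws) (d , opt′ , h) = let (f , opt″ , hs , keep) = repair opt′ ws in f , opt″ , go d f h hs keep
      where
      go : ∀ d f → (∀ y → W y → y < s ⊎ Happy c y → Happy d y) → Happy f s →
        (∀ x → W x → Happy d x → Happy f x) → ∀ y → W y → y < suc s ⊎ Happy c y → Happy f y
      go d f h hs keep y w (inj₂ p) = keep y w (h y w (inj₂ p))
      go d f h hs keep y w (inj₁ y<ss) with m≤n⇒m<n∨m≡n (≤-pred y<ss)
      ... | inj₁ y<s = keep y w (h y w (inj₁ y<s))
      ... | inj₂ refl = hs

  -- The pieces are the cones above the lowest vertices of W in P and, as piece 0, what lies outside P
  -- and the finite set of vertices below P.
  module Amalgamate (P : ℕ → Set) (s : ℕ) (up : ∀ {a v} → a ⊑ v → P a → P v)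
    (low : ∀ {u v} → ¬ P u → P v → u ⊑ v → u < s) (good-exit : ∀ a → W a → P a → Good (a ⊑_)) where

    Exit : ℕ → Set
    Exit a = (W a × P a) × (∀ b → W b → P b → b ⊑ a → b ≡ a)

    Below : ℕ → Set
    Below v = ∃ λ u → P u × v ⊑ u

    abstract
      exit-exists : ∀ y → W y → P y → ∃ λ a → Exit a × a ⊑ y
      exit-exists y w p = go (least (τ y , y , (w , p) , ⊑-refl , refl))
        where
        Level : ℕ → Set
        Level k = ∃ λ b → (W b × P b) × b ⊑ y × τ b ≡ k
        go : ∃ (Least Level) → ∃ λ a → Exit a × a ⊑ y
        go (k , (a , wp , a⊑y , refl) , min) = a , (wp , only) , a⊑y
          where
          only : ∀ b → W b → P b → b ⊑ a → b ≡ a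
          only b w p r with b ≟ a
          ... | yes q = q
          ... | no q = ⊥-elim (<⇒≱ (⊑-τ r q) (min (τ b) (b , (w , p) , ⊑-trans r a⊑y , refl)))

    exit-unique : ∀ {a b v} → Exit a → Exit b → a ⊑ v → b ⊑ v → a ≡ b
    exit-unique ((wa , pa) , ea) ((wb , pb) , eb) r q with ⊑-chain r q
    ... | inj₁ x = eb _ wa pa x
    ... | inj₂ x = sym (ea _ wb pb x)

    -- Only `exit` and `outer` vertices belong to pieces. A core vertex of `W` can only be `border`,
    -- hence below `s`, since every vertex of `W` in `P` lies above an exit.
    data Position (v : ℕ) : Set where
      rigid : X v → Position v
      exit : ∀ a → ¬ X v → P v → Exit a → a ⊑ v → Position v
      inner : P v → ¬ (∃ λ a → Exit a × a ⊑ v) → Position v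
      border : ¬ P v → Below v → Position v
      outer : ¬ X v → ¬ P v → ¬ Below v → Position v

    abstract
      position : ∀ v → Position v
      position v with lem (X v) | lem (P v) | lem (∃ λ a → Exit a × a ⊑ v) | lem (Below v)
      ... | yes x | _ | _ | _ = rigid x
      ... | no ¬x | yes p | yes (a , ea , r) | _ = exit a ¬x p ea r
      ... | no _ | yes p | no ¬a | _ = inner p ¬a
      ... | no _ | no ¬p | _ | yes b = border ¬p b
      ... | no ¬x | no ¬p | _ | no ¬b = outer ¬x ¬p ¬b

    piece-of : ∀ {v} → Position v → Maybe ℕ
    piece-of (exit a _ _ _ _) = just (suc a)
    piece-of (outer _ _ _) = just 0
    piece-of _ = nothing

    π : ℕ → Maybe ℕ
    π v = piece-of (position v)

    -- Apart from `X`, the core neighbours of the cone above `a` are ancestors of `a`, and those of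
    -- piece 0 lie below `s` by `low`.
    M : ℕ → ℕ
    M zero = s
    M (suc a) = proj₁ (⊑-bounded a)

    Near : ℕ → ℕ → Set
    Near k v = π v ≡ just k ⊎ (π v ≡ nothing × (v < M k ⊎ X v))

    near-exit : ∀ {a v} → ¬ X v → Exit a → a ⊑ v → π v ≡ just (suc a)
    near-exit {a} {v} ¬x ea r with position v
    ... | rigid x = ⊥-elim (¬x x)
    ... | exit b _ _ eb q = cong (just ∘ suc) (exit-unique eb ea q r)
    ... | inner _ ¬a = ⊥-elim (¬a (a , ea , r))
    ... | border ¬p _ = ⊥-elim (¬p (up r (proj₂ (proj₁ ea))))
    ... | outer _ ¬p _ = ⊥-elim (¬p (up r (proj₂ (proj₁ ea))))

    near-ancestor : ∀ {a v} → ¬ X v → Exit a → v ⊑ a → Near (suc a) v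
    near-ancestor {a} {v} ¬x ea r with position v
    ... | rigid x = ⊥-elim (¬x x)
    ... | exit b _ _ eb q = inj₁ (cong (just ∘ suc) (exit-unique eb ea (⊑-trans q r) ⊑-refl))
    ... | inner _ _ = inj₂ (refl , inj₁ (proj₂ (⊑-bounded a) v r))
    ... | border _ _ = inj₂ (refl , inj₁ (proj₂ (⊑-bounded a) v r))
    ... | outer _ ¬p ¬b = ⊥-elim (¬b (a , proj₂ (proj₁ ea) , r))

    rigid-core : ∀ {v} → X v → π v ≡ nothing
    rigid-core {v} x with position v
    ... | rigid _ = refl
    ... | exit _ ¬x _ _ _ = ⊥-elim (¬x x)
    ... | inner _ _ = refl
    ... | border _ _ = refl
    ... | outer ¬x _ _ = ⊥-elim (¬x x)

    -- The ends of an `H`-edge are comparable, so a neighbour of the cone above `a` lies in the cone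
    -- or below `a`. A neighbour of an outer vertex cannot lie in `P`, so it is outer or on the
    -- border.
    near-H : ∀ {u v k} → H u v → π u ≡ just k → Near k v
    near-H {u} {v} h e with position u
    near-H {u} {v} h refl | exit a ¬x p ea r with ⊑-edge h
    ... | inj₁ u⊑v = inj₁ (near-exit (¬Xʳ h) ea (⊑-trans r u⊑v))
    ... | inj₂ v⊑u with ⊑-chain r v⊑u
    ...   | inj₁ a⊑v = inj₁ (near-exit (¬Xʳ h) ea a⊑v)
    ...   | inj₂ v⊑a = near-ancestor (¬Xʳ h) ea v⊑a
    near-H {u} {v} h refl | outer ¬x ¬p ¬b = go (position v) refl
      where
      ¬Pv : ¬ P v
      ¬Pv pv with ⊑-edge h
      ... | inj₁ u⊑v = ¬b (v , pv , u⊑v)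
      ... | inj₂ v⊑u = ¬p (up v⊑u pv)
      go : (q : Position v) → π v ≡ piece-of q → Near 0 v
      go (rigid x) _ = ⊥-elim (¬Xʳ h x)
      go (exit _ _ pv _ _) _ = ⊥-elim (¬Pv pv)
      go (inner pv _) _ = ⊥-elim (¬Pv pv)
      go (border _ (w , pw , r)) eq = inj₂ (eq , inj₁ (low ¬Pv pw r))
      go (outer _ _ _) eq = inj₁ eq

    boundary : ∀ u v k → e u v ≡ true → π u ≡ just k → Near k v
    boundary u v k h p with lem (X v)
    ... | yes x = inj₂ (rigid-core x , inj₂ x)
    ... | no ¬x = near-H (edge (e-Adj u v h) ¬Xu ¬x (ends (e-F u v h))) p
      where
      ¬Xu : ¬ X u
      ¬Xu x with () ← trans (sym p) (rigid-core x)
      ends : F u ⊎ F v → F u ⊎ F v ⊎ parent u ≡ just v ⊎ parent v ≡ just u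
      ends (inj₁ f) = inj₁ f
      ends (inj₂ f) = inj₂ (inj₁ f)

    module _ (c₀ : Colouring) (opt₀ : Optimal c₀) where

      Extension : ℕ → Colouring → Set
      Extension n c = ∃ λ (d : ∃ Optimal) →
        ∀ y → W y → (W n × P n × n ⊑ y) ⊎ Happy c y → Happy (proj₁ d) y

      extend : ∀ n (c : ∃ Optimal) → Extension n (proj₁ c)
      extend n (c , opt) = go (lem (W n × P n))
        where
        go : Dec (W n × P n) → Extension n c
        go (no ¬n) = (c , opt) , λ
          { y w (inj₁ (wn , pn , _)) → ⊥-elim (¬n (wn , pn))
          ; y w (inj₂ h) → h }
        go (yes (wn , pn)) = let (d , opt′ , h) = improve (good-exit n wn pn) c opt in (d , opt′) , λ
          { y w (inj₁ (_ , _ , r)) → h y w (inj₁ r)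
          ; y w (inj₂ p) → h y w (inj₂ p) }

      -- Stage `n` treats the cone above `n`, if `n` is in `W` and `P`, and keeps what earlier
      -- stages achieved.
      sequence : ℕ → ∃ Optimal
      sequence zero = c₀ , opt₀
      sequence (suc n) = proj₁ (extend n (sequence n))

      c : ℕ → Colouring
      c n = proj₁ (sequence n)

      c-keeps : ∀ {m n} → m ≤′ n → ∀ y → W y → Happy (c m) y → Happy (c n) y
      c-keeps ≤′-refl y w h = h
      c-keeps (≤′-step {n} le) y w h = proj₂ (extend n (sequence n)) y w (inj₂ (c-keeps le y w h))

      c-makes : ∀ {a n y} → W a → P a → a ⊑ y → W y → a < n → Happy (c n) y
      c-makes {a} {n} {y} wa pa r w a<n = c-keeps (≤⇒≤′ a<n) y w
        (proj₂ (extend a (sequence a)) y w (inj₁ (wa , pa , r)))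

      c-optimal : ∀ n → OptimalOn (λ v → π v ≡ nothing → v < n) (c n)
      c-optimal n = proj₁ (proj₂ (sequence n)) , λ d fd _ → proj₂ (proj₂ (sequence n)) d fd

      module S = Splice π M boundary c c-optimal

      -- The vertices that `y` cares for are `H`-neighbours, hence near the piece, where `spliced`
      -- equals `c (index k)`.
      happy-piece : ∀ {k y} → W y → π y ≡ just k → Happy (c (S.index k)) y → Happy S.spliced y
      happy-piece {k} {y} w p = happy-transfer (sym (S.spliced-near k y (inj₁ p)))
        (0 , λ u _ care → sym (S.spliced-near k u (near-H (care-H w care) p)))

      spliced-happy : ∀ y → W y → P y ⊎ Happy c₀ y → y < s ⊎ Happy S.spliced y
      spliced-happy y w h = go (position y) refl h
        where
        go : (q : Position y) → π y ≡ piece-of q → P y ⊎ Happy c₀ y → y < s ⊎ Happy S.spliced y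
        go (rigid x) _ _ = ⊥-elim (proj₂ x w)
        -- As `index (suc a)` exceeds `a`, the piece is coloured as in a stage after the treatment
        -- of the cone above `a`.
        go (exit a _ _ ((wa , pa) , _) r) eq _ = inj₂ (happy-piece w eq (c-makes wa pa r w (S.index-≥ (suc a))))
        go (inner p ¬a) _ _ = ⊥-elim (¬a (exit-exists y w p))
        -- These finitely many vertices are left to `good-below` in `amalgamate`.
        go (border ¬p (u , pu , r)) _ _ = inj₁ (low ¬p pu r)
        go (outer _ ¬p _) _ (inj₁ p) = ⊥-elim (¬p p)
        go (outer _ _ _) eq (inj₂ h) = inj₂ (happy-piece w eq (c-keeps {0} {S.index 0} (≤⇒≤′ z≤n) y w h))

    amalgamate : Good (λ v → v < s ⊎ P v)
    amalgamate = good λ c₀ opt₀ →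
      let (d , opt , h) = improve (good-below s) (S.spliced c₀ opt₀) (S.spliced-optimal c₀ opt₀) in d , opt , λ
        { y w (inj₁ (inj₁ lt)) → h y w (inj₁ lt)
        ; y w (inj₁ (inj₂ p)) → h y w (spliced-happy c₀ opt₀ y w (inj₁ p))
        ; y w (inj₂ q) → h y w (spliced-happy c₀ opt₀ y w (inj₂ q)) }

  -- Induction along `Above W`, with the strict cone of `y` as `P`; the bound `s` takes care of `y`
  -- and its ancestors.
  good-cone : ∀ y → Acc (Above W) y → Good (y ⊑_)
  good-cone y (acc rs) = good λ c opt →
    let (d , opt′ , h) = improve (Amalgamate.amalgamate P s up low good-exit) c opt in
    d , opt′ , λ v w → h v w ∘ [ inj₁ ∘ split v , inj₂ ]′
    where
    P : ℕ → Set
    P v = y ⊑ v × y ≢ v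
    s : ℕ
    s = proj₁ (⊑-bounded y)
    up : ∀ {a v} → a ⊑ v → P a → P v
    up r (q , n) = ⊑-trans q r , λ { refl → n (⊑-antisym q r) }
    low : ∀ {u v} → ¬ P u → P v → u ⊑ v → u < s
    low {u} ¬p (q , _) r with ⊑-chain r q
    ... | inj₁ u⊑y = proj₂ (⊑-bounded y) u u⊑y
    ... | inj₂ y⊑u with y ≟ u
    ...   | yes refl = proj₂ (⊑-bounded y) y ⊑-refl
    ...   | no n = ⊥-elim (¬p (y⊑u , n))
    good-exit : ∀ a → W a → P a → Good (a ⊑_)
    good-exit a w p = good-cone a (rs (p , w))
    split : ∀ v → y ⊑ v → v < s ⊎ P v
    split v r with y ≟ v
    ... | yes refl = inj₁ (proj₂ (⊑-bounded y) y ⊑-refl)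
    ... | no n = inj₂ (r , n)

  -- From happiness and optimality to unfriendliness on ℕ.

  module _ (no-alternating : (ρ : ℕ → ℕ) → (∀ {i j} → ρ i ≡ ρ j → i ≡ j) → (∀ i → Adj (ρ i) (ρ (suc i))) →
      Infinite (λ i → F (ρ i)) → Infinite (λ i → ¬ F (ρ i)) → ⊥) where

    no-ray : ¬ RayIn W
    no-ray r = no-alternating ρ ρ-injective (λ i → adjacent (ρ-edge i))
      (F-often ρ ρ-injective ρ-edge) (infinite-map (λ _ → W⇒¬F) ρ-often)
      where open RayIn r

    all-happy : ∃ λ c → Optimal c × ∀ y → W y → Happy c y
    all-happy = let (d , opt , h) = top in d , opt , λ y w → h y w (inj₁ (inj₂ tt))
      where
      top : ∃ λ d → Optimal d × (∀ y → W y → (y < 0 ⊎ ⊤) ⊎ Happy (proj₁ optimal-exists) y → Happy d y)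
      -- With everything in `P`, the exits are the lowest vertices of `W`, and `s = 0` since nothing
      -- lies outside `P`.
      top = improve (Amalgamate.amalgamate (λ _ → ⊤) 0 (λ _ _ → tt) (λ h _ _ → ⊥-elim (h tt))
        (λ a w _ → good-cone a (above-accessible no-ray a w))) (proj₁ optimal-exists) (proj₂ optimal-exists)

    friends foes : Colouring → ℕ → ℕ → Bool
    friends c v u = adj v u ∧ agree (c v) (c u)
    foes c v u = adj v u ∧ agree (not (c v)) (c u)

    infinite-foes : ∀ c → Optimal c → (∀ y → W y → Happy c y) → ∀ v → ¬ F v →
      Infinite (λ u → foes c v u ≡ true)
    infinite-foes c opt happy v ¬f with lem (W v)
    ... | yes w = infinite-map (λ u (care , p) → foe u (care-Adj w care) (p ∘ sym)) (happy v w)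
      where
      foe : ∀ u → Adj v u → c v ≢ c u → foes c v u ≡ true
      foe u a p rewrite a | ≢⇒not p = agree-refl (not (c v))
    ... | no ¬w = infinite-map (λ u p → let (a , x) = child-X (¬f , ¬w) p in
            foe u a (trans (proj₁ opt u x) (trans (cX-parent p) (cong not (sym (proj₁ opt v (¬f , ¬w)))))))
            (parent-X v (¬f , ¬w))
      where
      foe : ∀ u → Adj v u → c u ≡ not (c v) → foes c v u ≡ true
      foe u a p rewrite a | p = agree-refl (not (c v))

    -- For finite degree this compares two finite numbers; with infinitely many foes it always
    -- holds.
    Content : Colouring → ℕ → Set
    Content c v = ∀ n → ∃ λ m → count (friends c v) n ≤ count (foes c v) m

    module _ (adj-irrefl : ∀ v → adj v v ≡ false) (c : Colouring) (v : ℕ) (f : F v) where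

      flipped : Colouring
      flipped = flip v c

      flipped-other : ∀ {u} → u ≢ v → flipped u ≡ c u
      flipped-other = ≔-other c (not (c v))

      flipped-row : ∀ j → j < v → mono e flipped v j ≡ 𝟙 (foes c v j)
      flipped-row j j<v = cong₂ (λ a b → 𝟙 (a ∧ b)) (F-e j f)
        (cong₂ agree (≔-same c v (not (c v))) (flipped-other (<⇒≢ j<v)))

      row : ∀ j → mono e c v j ≡ 𝟙 (friends c v j)
      row j = cong (λ a → 𝟙 (a ∧ agree (c v) (c j))) (F-e j f)

      flipped-before : E flipped v ≡ E c v
      flipped-before = sum-cong v λ i i<v → sum-cong i λ j j<i → mono-cong e flipped c i j λ _ →
        flipped-other (<⇒≢ i<v) , flipped-other (<⇒≢ (<-trans j<i i<v))

      column : ∀ n → n ≢ v → mono e flipped n v + 𝟙 (friends c v n) ≡ mono e c n v + 𝟙 (foes c v n)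
      column n n≢v = trans
        (cong₂ _+_
          (cong₂ (λ a b → 𝟙 (a ∧ b)) e-adj (trans (cong₂ agree (flipped-other n≢v) (≔-same c v (not (c v))))
            (agree-sym (c n) (not (c v)))))
          (cong₂ (λ a b → 𝟙 (a ∧ b)) (sym e-adj) (agree-sym (c v) (c n))))
        (+-comm (𝟙 (foes c v n)) _)
        where
        e-adj : e n v ≡ adj v n
        e-adj = trans (true-iff (e-sym n v) (e-sym v n)) (F-e n f)

      -- Flipping `v` exchanges friends and foes. Neighbours below `v` are counted in row `v`, the
      -- base case; those above appear in their own later rows.
      flip-balance : ∀ {n} → suc v ≤′ n → E flipped n + count (friends c v) n ≡ E c n + count (foes c v) n
      -- The counts up to `suc v` include `v` itself, which contributes 0 as there are no loops.
      flip-balance ≤′-refl rewrite adj-irrefl v = trans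
        (cong₂ (λ x y → x + y + (count (friends c v) v + 0)) flipped-before (sum-cong v flipped-row))
        (trans (swap (E c v) (count (foes c v) v) (count (friends c v) v))
          (cong (λ y → E c v + y + (count (foes c v) v + 0)) (sym (sum-cong v (λ j _ → row j)))))
        where
        swap : ∀ x y z → x + y + (z + 0) ≡ x + z + (y + 0)
        swap = solve 3 (λ x y z → x :+ y :+ (z :+ con 0) := x :+ z :+ (y :+ con 0)) refl
          where open +-*-Solver
      flip-balance (≤′-step {n} v<n) = trans
        (interchange (E flipped n) (sum n (mono e flipped n)) (count (friends c v) n) (𝟙 (friends c v n)))
        (trans (cong₂ _+_ (flip-balance v<n)
          (sum-change n v (mono e flipped n) (mono e c n) (𝟙 (friends c v n)) (𝟙 (foes c v n)) (≤′⇒≤ v<n)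
            (λ j j≢v → mono-cong e flipped c n j λ _ → flipped-other n≢v , flipped-other j≢v)
            (column n n≢v)))
          (sym (interchange (E c n) (sum n (mono e c n)) (count (foes c v) n) (𝟙 (foes c v n)))))
        where
        n≢v : n ≢ v
        n≢v refl = <-irrefl refl (≤′⇒≤ v<n)

      -- Optimality against the single flip, read through `flip-balance` at a sufficiently large
      -- `k`.
      finite-content : Optimal c → Content c v
      finite-content (_ , opt) n = k , ≤-trans (count-mono (friends c v) (≤⇒≤′ (m≤m⊔n n _))) enough
        where
        diff : FinDiff c flipped
        diff = suc v , go
          where
          go : DiffersBelow (suc v) c flipped
          go u p with u ≟ v
          ... | yes refl = f , ≤-refl
          ... | no _ = ⊥-elim (p refl)
        ev = opt flipped diff
        k : ℕ
        k = n ⊔ (suc v ⊔ proj₁ ev)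
        enough : count (friends c v) k ≤ count (foes c v) k
        enough = +-cancelˡ-≤ (E c k) _ _ (≤-trans
          (+-monoˡ-≤ (count (friends c v) k)
            (proj₂ ev k (≤-trans (m≤n⊔m (suc v) (proj₁ ev)) (m≤n⊔m n _))))
          (≤-reflexive (flip-balance (≤⇒≤′ (≤-trans (m≤m⊔n (suc v) (proj₁ ev)) (m≤n⊔m n _))))))

    all-content : (∀ v → adj v v ≡ false) → ∃ λ c → ∀ v → Content c v
    all-content irrefl = let (c , opt , happy) = all-happy in c , λ v → go c opt happy v (lem (F v))
      where
      go : ∀ c → Optimal c → (∀ y → W y → Happy c y) → ∀ v → Dec (F v) → Content c v
      go c opt happy v (yes f) = finite-content irrefl c v f opt
      go c opt happy v (no ¬f) n = count-infinite (foes c v) (infinite-foes c opt happy v ¬f) (count (friends c v) n)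

-- Transfer between `G` and ℕ.

module Transport (lem : LEM) (G : Graph) (code : Graph.V G → ℕ)
  (code-injective : ∀ {u v} → code u ≡ code v → u ≡ v)
  (no-alternating : ¬ Σ (Ray G) (Alternating G)) where

  open Graph G
  open Classical lem

  -- Numbers outside the image of `code` become isolated vertices, hence belong to `F`.
  Coded : ℕ → ℕ → Set
  Coded i j = Σ V λ u → Σ V λ v → code u ≡ i × code v ≡ j × E u v

  adj : ℕ → ℕ → Bool
  adj i j = ⟪ Coded i j ⟫

  adj-sym : ∀ i j → adj i j ≡ true → adj j i ≡ true
  adj-sym i j h = let (u , v , p , q , a) = ⟪⟫-elim h in ⟪⟫-intro (v , u , q , p , E-sym a)

  adj-irrefl : ∀ v → adj v v ≡ false
  adj-irrefl i with lem (Coded i i)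
  ... | no _ = refl
  ... | yes (u , v , p , q , a) = ⊥-elim (E-irrefl (subst (E u) (sym (code-injective (trans p (sym q)))) a))

  adj-intro : ∀ {u v} → E u v → adj (code u) (code v) ≡ true
  adj-intro {u} {v} a = ⟪⟫-intro (u , v , refl , refl , a)

  adj-elim : ∀ {u j} → adj (code u) j ≡ true → ∃ λ v → code v ≡ j × E u v
  adj-elim {u} h with ⟪⟫-elim h
  ... | u′ , v , p , q , a = v , q , subst (λ w → E w v) (code-injective p) a

  open Preparation lem adj adj-sym using (F)
  open Assembly lem adj adj-sym

  list-below : ∀ b → ∃ λ (vs : List V) → ∀ v → code v < b → v ∈ vs
  list-below zero = [] , λ _ ()
  list-below (suc b) with list-below b | lem (∃ λ v → code v ≡ b)
  ... | vs , h | yes (w , p) = w ∷ vs , go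
    where
    go : ∀ v → code v < suc b → v ∈ w ∷ vs
    go v lt with m≤n⇒m<n∨m≡n (≤-pred lt)
    ... | inj₁ v<b = there (h v v<b)
    ... | inj₂ q = here (code-injective (trans q (sym p)))
  ... | vs , h | no ¬p = vs , λ v lt → h v (≤∧≢⇒< (≤-pred lt) λ q → ¬p (v , q))

  F⇒FiniteDegree : ∀ {v} → F (code v) → FiniteDegree G v
  F⇒FiniteDegree {v} (b , h) = let (vs , q) = list-below b in vs , λ u a → q u (h (code u) (adj-intro a))

  code-bound : (vs : List V) → ∃ λ b → ∀ v → v ∈ vs → code v < b
  code-bound [] = 0 , λ _ ()
  code-bound (w ∷ vs) with code-bound vs
  ... | b , h = suc (code w) ⊔ b , λ
    { v (here refl) → m≤m⊔n (suc (code v)) b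
    ; v (there p) → ≤-trans (h v p) (m≤n⊔m (suc (code w)) b) }

  FiniteDegree⇒F : ∀ {v} → FiniteDegree G v → F (code v)
  FiniteDegree⇒F {v} (vs , h) = let (b , q) = code-bound vs in b , λ j a →
    let (u , p , a′) = adj-elim a in subst (_< b) p (q u (h u a′))

  no-coded-ray : (ρ : ℕ → ℕ) → (∀ {i j} → ρ i ≡ ρ j → i ≡ j) → (∀ i → adj (ρ i) (ρ (suc i)) ≡ true) →
    Infinite (λ i → F (ρ i)) → Infinite (λ i → ¬ F (ρ i)) → ⊥
  no-coded-ray ρ ρ-injective ρ-edge often-F often-¬F = no-alternating (ray , fins , infs)
    where
    vertex : ∀ i → ∃ λ v → code v ≡ ρ i
    vertex i = let (u , _ , p , _) = ⟪⟫-elim (ρ-edge i) in u , p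
    vtx : ℕ → V
    vtx i = proj₁ (vertex i)
    vtx-code : ∀ i → code (vtx i) ≡ ρ i
    vtx-code i = proj₂ (vertex i)
    ray : Ray G
    ray = record
      { vtx = vtx
      ; inj = λ {i} {j} e → ρ-injective (trans (sym (vtx-code i)) (trans (cong code e) (vtx-code j)))
      ; edge = λ i →
          let (w , p , a) = adj-elim {vtx i}
                (subst (λ x → adj x (ρ (suc i)) ≡ true) (sym (vtx-code i)) (ρ-edge i))
          in subst (E (vtx i)) (code-injective (trans p (sym (vtx-code (suc i))))) a }
    fins : ∀ n → ∃ λ m → n ≤ m × FiniteDegree G (vtx m)
    fins n = let (m , n≤m , f) = often-F n in m , n≤m , F⇒FiniteDegree (subst F (sym (vtx-code m)) f)
    infs : ∀ n → ∃ λ m → n ≤ m × ¬ FiniteDegree G (vtx m)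
    infs n = let (m , n≤m , ¬f) = often-¬F n in m , n≤m , λ d → ¬f (subst F (vtx-code m) (FiniteDegree⇒F d))

  unfriendly : Σ (V → Bool) (Unfriendly G)
  unfriendly = let (c , content) = all-content no-coded-ray adj-irrefl in c ∘ code , λ v → embed c v (content (code v))
    where
    embed : ∀ c v → Content no-coded-ray c (code v) →
      _≼_ G (λ u → N G v u × c (code u) ≡ c (code v)) (λ u → N G v u × c (code u) ≢ c (code v))
    embed c v h = (λ u p → proj₁ (target u p)) , (λ u p → proj₂ (proj₂ (target u p))) ,
      λ u u′ p p′ eq → code-injective (f-injective (code u) (code u′) (friend p) (friend p′)
        (trans (sym (proj₁ (proj₂ (target u p)))) (trans (cong code eq) (proj₁ (proj₂ (target u′ p′))))))
      where
      embedding = count-embed (friends no-coded-ray c (code v)) (foes no-coded-ray c (code v)) h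
      f = proj₁ embedding
      f-foe = proj₁ (proj₂ embedding)
      f-injective = proj₂ (proj₂ embedding)
      friend : ∀ {u} → N G v u × c (code u) ≡ c (code v) → friends no-coded-ray c (code v) (code u) ≡ true
      friend {u} (a , p) rewrite adj-intro a | p = agree-refl (c (code v))
      foe≢ : ∀ x y → agree (not x) y ≡ true → y ≢ x
      foe≢ true .true () refl
      foe≢ false .false () refl
      target : ∀ u (p : N G v u × c (code u) ≡ c (code v)) →
        ∃ λ w → code w ≡ f (code u) (friend p) × N G v w × c (code w) ≢ c (code v)
      target u p = go (∧-true (f-foe (code u) (friend p)))
        where
        j = f (code u) (friend p)
        go : adj (code v) j ≡ true × agree (not (c (code v))) (c j) ≡ true →
          ∃ λ w → code w ≡ j × N G v w × c (code w) ≢ c (code v)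
        go (a , ag) = let (w , q , b) = adj-elim a in
          w , q , b , subst (λ x → c x ≢ c (code v)) (sym q) (foe≢ (c (code v)) (c j) ag)

theorem1p1 : LEM → (G : Graph) → Countable G →
    ¬ Σ (Ray G) (Alternating G) →
    Σ (Graph.V G → Bool) (Unfriendly G)
theorem1p1 lem G (code , inj) no-alternating = Transport.unfriendly lem G code inj no-alternating
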